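{- Let $p\geq 3$ be a prime, let $w=e^{2\pi i/p}$, and for $F\in\mathbb Z[x,y]$ put $$M_{\mathbb Z_p^2}(F)=\prod_{i=0}^{p-1}\prod_{j=0}^{p-1}F(w^i,w^j)\in\mathbb Z .$$ If $p\mid M_{\mathbb Z_p^2}(F)$ then $p^{p+3}\mid M_{\mathbb Z_p^2}(F)$. Moreover, for every integer $k\geq 0$ there exists $F\in\mathbb Z[x,y]$ with $p^{p+3+k}\parallel M_{\mathbb Z_p^2}(F)$ (i.e. $p^{p+3+k}$ divides it but $p^{p+4+k}$ does not).
   Context: $M_{\mathbb Z_p^2}(F)$ is the integer group determinant of the group $\mathbb Z_p\times\mathbb Z_p$ evaluated at the coefficients of $F$ (reduced modulo $x^p-1,y^p-1$). The notation $p^e\parallel N$ means $p^e\mid N$ and $p^{e+1}\nmid N$. -}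

module Defs where

open import Data.Nat as ℕ using (ℕ; zero; suc; NonZero)
open import Data.Nat.DivMod using (_mod_)
open import Data.Fin as Fin using (Fin; toℕ; punchIn; quotRem)
open import Data.Integer as ℤ using (ℤ; +_; _+_; _*_; -_)
open import Data.List using (List; []; _∷_)
open import Data.Product using (_,_; proj₁; proj₂)
open import Relation.Nullary.Decidable using (does)
open import Data.Bool using (if_then_else_)

∑ : ∀ {n} → (Fin n → ℤ) → ℤ
∑ {zero}  f = + 0
∑ {suc n} f = f Fin.zero + ∑ (λ i → f (Fin.suc i))

sign : ℕ → ℤ
sign zero          = + 1
sign (suc zero)    = - (+ 1)
sign (suc (suc k)) = sign k

det : ∀ n → (Fin n → Fin n → ℤ) → ℤ
det zero    A = + 1
det (suc n) A =
  ∑ (λ j → sign (toℕ j) * (A Fin.zero j * det n (λ r c → A (Fin.suc r) (punchIn j c))))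

-- Polynomials in ℤ[x,y]: a list of rows, the i-th row (from 0) being the
-- list of coefficients of x^i y^0, x^i y^1, ...   (every polynomial has such
-- a representation).
Poly : Set
Poly = List (List ℤ)

-- Coefficients of F reduced modulo x^p - 1, y^p - 1: the coefficient of
-- x^a y^b (a, b ∈ ℤ_p) is the sum of the coefficients c_{ij} of F with
-- i ≡ a and j ≡ b (mod p).
module _ (p : ℕ) .{{_ : NonZero p}} where

  private
    rowRed : ℕ → List ℤ → Fin p → ℤ
    rowRed j []       b = + 0
    rowRed j (c ∷ cs) b =
      (if does (j mod p Fin.≟ b) then c else + 0) + rowRed (suc j) cs b

    polyRed : ℕ → Poly → Fin p → Fin p → ℤ
    polyRed i []       a b = + 0
    polyRed i (r ∷ rs) a b =
      (if does (i mod p Fin.≟ a) then rowRed 0 r b else + 0) + polyRed (suc i) rs a b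

  reduce : Poly → Fin p → Fin p → ℤ
  reduce = polyRed 0

  subₚ : Fin p → Fin p → Fin p
  subₚ a b = (toℕ a ℕ.+ (p ℕ.∸ toℕ b)) mod p

  -- Integer group determinant of ℤ_p × ℤ_p at coefficients a:
  -- det (a (g - h))_{g,h ∈ ℤ_p × ℤ_p}, group elements being indexed by
  -- Fin (p * p) via quotRem.
  groupDet : (Fin p → Fin p → ℤ) → ℤ
  groupDet a = det (p ℕ.* p) (λ g h →
    let g₁ = proj₂ (quotRem {p} p g) ; g₂ = proj₁ (quotRem {p} p g)
        h₁ = proj₂ (quotRem {p} p h) ; h₂ = proj₁ (quotRem {p} p h)
    in a (subₚ g₁ h₁) (subₚ g₂ h₂))

  M : Poly → ℤ
  M F = groupDet (reduce F)

-- Work in R = ℤ[w] = ℤ[X] / (1 + X + ⋯ + X^(p-1)). The characters of ℤ_p × ℤ_p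
-- diagonalise the group matrix, so M = ∏ λ_ij with λ_ij = F(w^i, w^j).
-- Put π = 1 - w. Then π^(p-1) = p u with u ≡ -1 (mod π), and an integer divisible
-- by π in R is divisible by p. Since w^m ≡ 1 - m π (mod π²),
--   λ_ij ≡ F(1,1) - (i α + j β) π  (mod π²),   α = F_x(1,1), β = F_y(1,1).
-- If p ∣ M then M ≡ F(1,1)^(p²) (mod π) forces p ∣ F(1,1) = λ_00, every λ_ij is
-- divisible by π, and those with p ∣ i α + j β by π². There are at least p - 1 of
-- the latter besides λ_00, whence p π^((p-1)(p+2)) ∣ M and so p^(p+3) ∣ M.
-- For F = (y - 1) + (x - 1)² + p^k (1 + x + ⋯ + x^(p-1)) every cofactor is a unit
-- modulo π and λ_00 = p^(k+1), which gives p^(p+3+k) ∥ M.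
module Submission where

open import Level using (_⊔_; 0ℓ)
open import Algebra.Bundles using (CommutativeMonoid; CommutativeRing)
import Algebra.Properties.CommutativeMonoid.Sum as MonoidSum
import Algebra.Properties.Ring as RingProperties
import Algebra.Properties.Semiring.Sum as SemiringSum
import Algebra.Solver.Ring as RingSolver
open import Algebra.Solver.Ring.AlmostCommutativeRing using (fromCommutativeRing; _-Raw-AlmostCommutative⟶_)
import Algebra.Solver.Ring.NaturalCoefficients.Default as SemiringSolver
open import Data.Bool using (if_then_else_)
open import Data.Fin as Fin using (Fin; zero; suc; toℕ; punchIn)
import Data.Fin.Permutation as Perm
import Data.Fin.Properties as Fin
open import Data.Integer as ℤ using (ℤ; +_; -[1+_])
import Data.Integer.Divisibility as ℤ
import Data.Integer.Divisibility.Signed as ℤˢ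
import Data.Integer.DivMod as ℤ
import Data.Integer.Properties as ℤ
open import Data.Integer.Tactic.RingSolver using (solve-∀)
open import Data.List as List using (List)
open import Data.Maybe using (Maybe; just; nothing)
open import Data.Nat as ℕ using (ℕ; zero; suc; NonZero; s≤s; z<s; s<s)
import Data.Nat.Coprimality as Coprime
import Data.Nat.Divisibility as ℕ
import Data.Nat.DivMod as ℕ
import Data.Nat.GCD as GCD
open import Data.Nat.Primality using (Prime; euclidsLemma; prime⇒irreducible; ¬prime[1])
import Data.Nat.Properties as ℕ
import Data.Nat.Tactic.RingSolver as ℕSolver
open import Data.Product using (∃; _×_; _,_; proj₁; proj₂)
open import Data.Sum using (_⊎_; inj₁; inj₂)
open import Data.Unit.Polymorphic using (⊤)
import Data.Vec.Functional as Vec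
import Data.Vec.Functional.Properties as Vec
open import Function using (_∘_)
open import Relation.Binary.PropositionalEquality as ≡ using (_≡_; _≢_)
open import Relation.Nullary using (¬_; Dec; yes; no; contradiction)
open import Relation.Nullary.Decidable using (does; dec-true; dec-false)
import Defs


-- What is used of the ring is listed in `CyclotomicIntegers`: 1 + w + ⋯ + w^(p-1) = 0, no
-- p-torsion, and descent of divisibility between integers from R to ℤ. Only divisors of powers of p
-- are ever cancelled, and these are regular because p is. Valuations appear as explicit cofactors;
-- since R/π = 𝔽_p, a cofactor is certified prime to π by an integer residue prime to p. The p² - 1
-- factors other than λ_00 give one π each and at least p - 1 of them a second one, because the
-- linear form i α + j β vanishes on at least a line of 𝔽_p²; and p² - 1 + (p - 1) = (p - 1)(p + 2).
-- The witness has to make each of these orders exact. The term y - 1 gives order 1 for j ≠ 0, and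
-- (x - 1)² gives order 2 for i ≠ 0 = j. The sum 1 + x + ⋯ + x^(p-1) is p at i = 0 and 0 elsewhere,
-- so p^k times it sets λ_00; at (0 , j) it adds only a multiple of π², as p ≥ 3.

-- The iterated operation is opaque so that unification can recover the
-- indexed family from it.
module BigOperator {c ℓ} (M : CommutativeMonoid c ℓ) where
  open CommutativeMonoid M
  module S = MonoidSum M
  open import Relation.Binary.Reasoning.Setoid setoid

  opaque
    ⨁ : ∀ {n} → (Fin n → Carrier) → Carrier
    ⨁ = S.sum

    ⨁-zero : (f : Fin 0 → Carrier) → ⨁ f ≈ ε
    ⨁-zero f = refl

    ⨁-suc : ∀ {n} (f : Fin (suc n) → Carrier) → ⨁ f ≈ f zero ∙ ⨁ (f ∘ suc)
    ⨁-suc f = refl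

    ⨁-cong : ∀ {n} {f g : Fin n → Carrier} → (∀ i → f i ≈ g i) → ⨁ f ≈ ⨁ g
    ⨁-cong h = S.sum-cong-≋ h

    ⨁-∙ : ∀ {n} (f g : Fin n → Carrier) → ⨁ (λ i → f i ∙ g i) ≈ ⨁ f ∙ ⨁ g
    ⨁-∙ = S.∑-distrib-+

    ⨁-ε : ∀ n → ⨁ {n} (λ _ → ε) ≈ ε
    ⨁-ε = S.sum-replicate-zero

    ⨁-comm : ∀ {m n} (f : Fin m → Fin n → Carrier) →
             ⨁ (λ i → ⨁ (f i)) ≈ ⨁ (λ j → ⨁ (λ i → f i j))
    ⨁-comm f = S.∑-comm f

    ⨁-punchIn : ∀ {n} (i : Fin (suc n)) (f : Fin (suc n) → Carrier) →
                ⨁ f ≈ f i ∙ ⨁ (f ∘ punchIn i)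
    ⨁-punchIn i f = S.sum-remove f

    ⨁-permute : ∀ {n} (f : Fin n → Carrier) (π : Perm.Permutation n n) →
                ⨁ f ≈ ⨁ (λ i → f (π Perm.⟨$⟩ʳ i))
    ⨁-permute f π = S.sum-permute f π

  ⨁-single : ∀ {n} (i : Fin n) {f : Fin n → Carrier} →
             (∀ j → j ≢ i → f j ≈ ε) → ⨁ f ≈ f i
  ⨁-single {suc n} i {f} h = begin
    ⨁ f                        ≈⟨ ⨁-punchIn i f ⟩
    f i ∙ ⨁ (f ∘ punchIn i)    ≈⟨ ∙-congˡ (⨁-cong λ j → h _ (Fin.punchInᵢ≢i i j)) ⟩
    f i ∙ ⨁ {n} (λ _ → ε)      ≈⟨ ∙-congˡ (⨁-ε n) ⟩
    f i ∙ ε                    ≈⟨ identityʳ (f i) ⟩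
    f i                        ∎

  ⨁-involution : ∀ {n} (σ : Fin n → Fin n) → (∀ i → σ (σ i) ≡ i) →
                 (f : Fin n → Carrier) → ⨁ (f ∘ σ) ≈ ⨁ f
  ⨁-involution σ inv f = sym (⨁-permute f (Perm.permutation σ σ
    inv inv))

  ⨁-++ : ∀ {m n} (f : Fin (m ℕ.+ n) → Carrier) →
         ⨁ f ≈ ⨁ (λ i → f (i Fin.↑ˡ n)) ∙ ⨁ (λ j → f (m Fin.↑ʳ j))
  ⨁-++ {zero} f = sym (trans (∙-congʳ (⨁-zero _)) (identityˡ _))
  ⨁-++ {suc m} {n} f = begin
    ⨁ f                          ≈⟨ ⨁-suc f ⟩
    f zero ∙ ⨁ (f ∘ suc)         ≈⟨ ∙-congˡ (⨁-++ {m} {n} (f ∘ suc)) ⟩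
    f zero ∙ (_ ∙ _)             ≈⟨ assoc _ _ _ ⟨
    (f zero ∙ _) ∙ _             ≈⟨ ∙-congʳ (⨁-suc _) ⟨
    _ ∙ _                        ∎

  ⨁-combine : ∀ {m n} (f : Fin (m ℕ.* n) → Carrier) →
              ⨁ f ≈ ⨁ (λ i → ⨁ (λ j → f (Fin.combine {m} {n} i j)))
  ⨁-combine {zero} f = trans (⨁-zero f) (sym (⨁-zero _))
  ⨁-combine {suc m} {n} f = begin
    ⨁ f                                          ≈⟨ ⨁-++ {n} {m ℕ.* n} f ⟩
    ⨁ (λ j → f (j Fin.↑ˡ (m ℕ.* n))) ∙ _         ≈⟨ ∙-congˡ (⨁-combine {m} {n} _) ⟩
    _ ∙ _                                        ≈⟨ ⨁-suc _ ⟨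
    ⨁ (λ i → ⨁ (λ j → f (Fin.combine {suc m} {n} i j))) ∎

  ⨁-remQuot : ∀ {m n} (f : Fin m → Fin n → Carrier) →
              ⨁ {m ℕ.* n} (λ h → f (Fin.quotient n h) (Fin.remainder {m} n h)) ≈ ⨁ (λ i → ⨁ (f i))
  ⨁-remQuot {m} {n} f = trans (⨁-combine {m} {n} _) (⨁-cong λ i → ⨁-cong λ j →
    reflexive (≡.cong (λ (a , b) → f a b) (Fin.remQuot-combine {m} {n} i j)))

-- Finite sums and products in a commutative ring

module Sums {c ℓ} (R : CommutativeRing c ℓ) where
  open CommutativeRing R hiding (zero)
  open import Algebra.Properties.Semiring.Exp semiring public using (_^_; ^-congˡ; ^-homo-*; ^-assocʳ)
  module Sum = BigOperator +-commutativeMonoid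
  module Prod = BigOperator *-commutativeMonoid
  open Sum public using () renaming
    ( ⨁ to ∑; ⨁-zero to ∑-zero; ⨁-suc to ∑-suc; ⨁-cong to ∑-cong; ⨁-∙ to ∑-+; ⨁-ε to ∑-0
    ; ⨁-comm to ∑-comm; ⨁-single to ∑-single; ⨁-involution to ∑-involution; ⨁-remQuot to ∑-remQuot)
  open Prod public using () renaming
    ( ⨁ to ∏; ⨁-zero to ∏-zero; ⨁-suc to ∏-suc; ⨁-cong to ∏-cong
    ; ⨁-comm to ∏-comm; ⨁-punchIn to ∏-punchIn; ⨁-remQuot to ∏-remQuot)

  opaque
    unfolding Sum.⨁

    *-∑ : ∀ {n} x (f : Fin n → Carrier) → x * ∑ f ≈ ∑ (λ i → x * f i)
    *-∑ x f = SemiringSum.*-distribˡ-sum semiring x f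

    ∑-* : ∀ {n} x (f : Fin n → Carrier) → ∑ f * x ≈ ∑ (λ i → f i * x)
    ∑-* x f = SemiringSum.*-distribʳ-sum semiring x f

  ∏-const : ∀ n x → ∏ {n} (λ _ → x) ≈ x ^ n
  ∏-const zero    x = ∏-zero _
  ∏-const (suc n) x = trans (∏-suc _) (*-congˡ (∏-const n x))


-- The determinant as an alternating multilinear form

punchIn-cases : ∀ {ℓ n} (P : Fin (suc n) → Set ℓ) (i : Fin (suc n)) →
                P i → (∀ k → P (punchIn i k)) → ∀ j → P j
punchIn-cases P i pᵢ p j with i Fin.≟ j
... | yes ≡.refl = pᵢ
... | no  i≢j    = ≡.subst P (Fin.punchIn-punchOut i≢j) (p _)

module Determinant {c ℓ} (R : CommutativeRing c ℓ) where
  open CommutativeRing R hiding (zero)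
  open RingProperties ring using (-‿distribˡ-*; -‿distribʳ-*; -‿involutive)
  open Sums R
  open SemiringSolver commutativeSemiring using (solve; _:+_; _:*_; _:=_)
  open import Relation.Binary.Reasoning.Setoid setoid

  Matrix : ℕ → ℕ → Set c
  Matrix m n = Fin m → Fin n → Carrier

  infix 4 _≋_
  _≋_ : ∀ {n} → (Fin n → Carrier) → (Fin n → Carrier) → Set ℓ
  u ≋ v = ∀ j → u j ≈ v j

  infixr 5 _∷_
  _∷_ : ∀ {m n} → (Fin n → Carrier) → Matrix m n → Matrix (suc m) n
  _∷_ = Vec._∷_

  sgn : ℕ → Carrier
  sgn zero    = 1#
  sgn (suc k) = - sgn k

  det : ∀ n → Matrix n n → Carrier
  det zero    A = 1#
  det (suc n) A =
    ∑ (λ j → sgn (toℕ j) * (A zero j * det n (λ r c → A (suc r) (punchIn j c))))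

  diag : ∀ {n} → (Fin n → Carrier) → Matrix n n
  diag d i j = if does (i Fin.≟ j) then d i else 0#

  diag-≡ : ∀ {n} (d : Fin n → Carrier) i → diag d i i ≈ d i
  diag-≡ d i rewrite dec-true (i Fin.≟ i) ≡.refl = refl

  diag-≢ : ∀ {n} (d : Fin n → Carrier) {i j} → i ≢ j → diag d i j ≈ 0#
  diag-≢ d {i} {j} i≢j rewrite dec-false (i Fin.≟ j) i≢j = refl

  I : ∀ {n} → Matrix n n
  I = diag (λ _ → 1#)

  -- Rectangular matrices are allowed because fixing the first row of a form leaves a form in fewer
  -- rows of the same length. Linearity compares three matrices that agree off row i, so that no
  -- updated matrix has to be named.
  record Alternating {m n} (Φ : Matrix m n → Carrier) : Set (c ⊔ ℓ) where
    field
      cong        : ∀ {A B} → (∀ i → A i ≋ B i) → Φ A ≈ Φ B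
      linear      : ∀ i x y {A B C} → (∀ k → k ≢ i → A k ≋ C k) → (∀ k → k ≢ i → B k ≋ C k) →
                    (∀ j → C i j ≈ x * A i j + y * B i j) → Φ C ≈ x * Φ A + y * Φ B
      alternating : ∀ {A} i k → i ≢ k → A i ≋ A k → Φ A ≈ 0#

    additive : ∀ i {A B C} → (∀ k → k ≢ i → A k ≋ C k) → (∀ k → k ≢ i → B k ≋ C k) →
               (∀ j → C i j ≈ A i j + B i j) → Φ C ≈ Φ A + Φ B
    additive i a b e = trans
      (linear i 1# 1# a b λ j → trans (e j) (sym (+-cong (*-identityˡ _) (*-identityˡ _))))
      (+-cong (*-identityˡ _) (*-identityˡ _))

  det-cong : ∀ n {A B : Matrix n n} → (∀ i → A i ≋ B i) → det n A ≈ det n B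
  det-cong zero    h = refl
  det-cong (suc n) h = ∑-cong λ j → *-congˡ {sgn (toℕ j)} (*-cong (h zero j)
    (det-cong n λ r c → h (suc r) (punchIn j c)))

  det-linear : ∀ n i x y {A B C : Matrix n n} → (∀ k → k ≢ i → A k ≋ C k) →
               (∀ k → k ≢ i → B k ≋ C k) → (∀ j → C i j ≈ x * A i j + y * B i j) →
               det n C ≈ x * det n A + y * det n B
  det-linear (suc n) i x y {A} {B} {C} a b e = begin
    det (suc n) C                                    ≈⟨ ∑-cong (λ j → term i a b e j) ⟩
    ∑ (λ j → x * term′ A j + y * term′ B j)          ≈⟨ ∑-+ _ _ ⟩
    ∑ (λ j → x * term′ A j) + ∑ (λ j → y * term′ B j)
      ≈⟨ +-cong (*-∑ x _) (*-∑ y _) ⟨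
    x * det (suc n) A + y * det (suc n) B            ∎
    where
    minor : Matrix (suc n) (suc n) → Fin (suc n) → Carrier
    minor A j = det n (λ r c → A (suc r) (punchIn j c))
    term′ : Matrix (suc n) (suc n) → Fin (suc n) → Carrier
    term′ A j = sgn (toℕ j) * (A zero j * minor A j)
    term : ∀ i → (∀ k → k ≢ i → A k ≋ C k) → (∀ k → k ≢ i → B k ≋ C k) →
           (∀ j → C i j ≈ x * A i j + y * B i j) →
           ∀ j → term′ C j ≈ x * term′ A j + y * term′ B j
    term zero a b e j = begin
      sgn (toℕ j) * (C zero j * minor C j)
        ≈⟨ *-congˡ (*-congʳ (e j)) ⟩
      sgn (toℕ j) * ((x * A zero j + y * B zero j) * minor C j)
        ≈⟨ solve 6 (λ s x a y b m → s :* ((x :* a :+ y :* b) :* m)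
             := x :* (s :* (a :* m)) :+ y :* (s :* (b :* m))) refl _ x _ y _ _ ⟩
      x * (sgn (toℕ j) * (A zero j * minor C j)) + y * (sgn (toℕ j) * (B zero j * minor C j))
        ≈⟨ +-cong (*-congˡ (*-congˡ (*-congˡ (det-cong n λ r c → a (suc r) (λ ()) _))))
                  (*-congˡ (*-congˡ (*-congˡ (det-cong n λ r c → b (suc r) (λ ()) _)))) ⟨
      x * term′ A j + y * term′ B j ∎
    term (suc i) a b e j = begin
      sgn (toℕ j) * (C zero j * minor C j)
        ≈⟨ *-congˡ (*-congˡ (det-linear n i x y (λ k k≢i c → a (suc k) (k≢i ∘ Fin.suc-injective) _)
             (λ k k≢i c → b (suc k) (k≢i ∘ Fin.suc-injective) _) (λ c → e _))) ⟩
      sgn (toℕ j) * (C zero j * (x * minor A j + y * minor B j))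
        ≈⟨ solve 6 (λ s c x m y m′ → s :* (c :* (x :* m :+ y :* m′))
             := x :* (s :* (c :* m)) :+ y :* (s :* (c :* m′))) refl _ _ x _ y _ ⟩
      x * (sgn (toℕ j) * (C zero j * minor A j)) + y * (sgn (toℕ j) * (C zero j * minor B j))
        ≈⟨ +-cong (*-congˡ (*-congˡ (*-congʳ (a zero (λ ()) j))))
                  (*-congˡ (*-congˡ (*-congʳ (b zero (λ ()) j)))) ⟨
      x * term′ A j + y * term′ B j ∎

  -- The transpose of the pair of columns (0 , l + 1) has index (l + 1 , 0), and the pairs avoiding
  -- column 0 form a smaller family of the same shape; hence the recursion.
  Cancelling : ∀ n → (Fin (suc n) → Fin n → Carrier) → Set ℓ
  Cancelling zero    h = ⊤
  Cancelling (suc n) h =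
    (∀ l → h zero l + h (suc l) zero ≈ 0#) × Cancelling n (λ j l → h (suc j) (suc l))

  cancelling-resp : ∀ n {h h′} → (∀ j l → h j l ≈ h′ j l) → Cancelling n h → Cancelling n h′
  cancelling-resp zero    e _       = _
  cancelling-resp (suc n) e (z , r) =
    (λ l → trans (sym (+-cong (e _ _) (e _ _))) (z l)) ,
    cancelling-resp n (λ j l → e (suc j) (suc l)) r

  ∑∑-cancelling : ∀ n h → Cancelling n h → ∑ (λ j → ∑ (h j)) ≈ 0#
  ∑∑-cancelling zero    h _       = trans (∑-cong λ j → ∑-zero (h j)) (∑-0 1)
  ∑∑-cancelling (suc n) h (z , r) = begin
    ∑ (λ j → ∑ (h j))                             ≈⟨ ∑-suc _ ⟩
    ∑ (h zero) + ∑ (λ j → ∑ (h (suc j)))          ≈⟨ +-congˡ (∑-cong λ j → ∑-suc (h (suc j))) ⟩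
    ∑ (h zero) + ∑ (λ j → h (suc j) zero + ∑ (λ l → h (suc j) (suc l)))
                                                  ≈⟨ +-congˡ (∑-+ _ _) ⟩
    ∑ (h zero) + (∑ (λ j → h (suc j) zero) + _)   ≈⟨ +-assoc _ _ _ ⟨
    (∑ (h zero) + ∑ (λ j → h (suc j) zero)) + _   ≈⟨ +-congʳ (∑-+ _ _) ⟨
    ∑ (λ l → h zero l + h (suc l) zero) + _       ≈⟨ +-cong (∑-cong z) (∑∑-cancelling n _ r) ⟩
    ∑ {suc n} (λ _ → 0#) + 0#                     ≈⟨ trans (+-identityʳ _) (∑-0 (suc n)) ⟩
    0#                                            ∎

  -- (j , punchIn j l) runs through the ordered pairs of distinct columns, and
  -- transposing the pair reverses the sign.
  cancelling-pairs : ∀ k (g : Fin (2 ℕ.+ k) → Fin (2 ℕ.+ k) → Carrier) →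
    (∀ a b → g a b ≈ g b a) → (E : (Fin k → Fin (2 ℕ.+ k)) → Carrier) →
    (∀ f f′ → (∀ c → f c ≡ f′ c) → E f ≈ E f′) →
    Cancelling (suc k) (λ j l → (sgn (toℕ j) * sgn (toℕ l)) *
                                (g j (punchIn j l) * E (λ c → punchIn j (punchIn l c))))
  cancelling-pairs k g g-sym E E-cong = first , rest k g g-sym E E-cong
    where
    first : ∀ l → (1# * sgn (toℕ l)) * (g zero (suc l) * E (λ c → suc (punchIn l c)))
                  + (- sgn (toℕ l) * 1#) * (g (suc l) zero * E (λ c → suc (punchIn l c))) ≈ 0#
    first l = begin
      _ + (- sgn (toℕ l) * 1#) * (g (suc l) zero * _)
        ≈⟨ +-congˡ (*-cong (trans (*-comm _ _) (sym (-‿distribʳ-* _ _))) (*-congʳ (g-sym _ _))) ⟩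
      _ + - (1# * sgn (toℕ l)) * (g zero (suc l) * _)   ≈⟨ +-congˡ (-‿distribˡ-* _ _) ⟨
      _ + - ((1# * sgn (toℕ l)) * (g zero (suc l) * _)) ≈⟨ -‿inverseʳ _ ⟩
      0# ∎
    rest : ∀ k (g : Fin (2 ℕ.+ k) → Fin (2 ℕ.+ k) → Carrier) →
      (∀ a b → g a b ≈ g b a) → (E : (Fin k → Fin (2 ℕ.+ k)) → Carrier) →
      (∀ f f′ → (∀ c → f c ≡ f′ c) → E f ≈ E f′) →
      Cancelling k (λ j l → (- sgn (toℕ j) * - sgn (toℕ l)) *
         (g (suc j) (suc (punchIn j l)) * E (λ c → punchIn (suc j) (punchIn (suc l) c))))
    rest zero    g g-sym E E-cong = _
    -- Away from column 0 both signs are negated, which cancels. The remaining columns are column 0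
    -- and those of the smaller pair shifted by one, so `E` is precomposed with `Fin.lift 1`.
    rest (suc k) g g-sym E E-cong = cancelling-resp (suc k)
      (λ j l → *-cong (sym (neg-neg (sgn (toℕ j)) (sgn (toℕ l)))) (*-congˡ {g (suc j) (suc (punchIn j l))}
        (E-cong (Fin.lift 1 (λ c → punchIn j (punchIn l c))) (λ c → punchIn (suc j) (punchIn (suc l) c)) λ { zero → ≡.refl ; (suc c) → ≡.refl })))
      (cancelling-pairs k (λ a b → g (suc a) (suc b)) (λ a b → g-sym _ _)
        (λ f → E (Fin.lift 1 f)) (λ f f′ e → E-cong _ _ λ { zero → ≡.refl ; (suc c) → ≡.cong suc (e c) }))
      where
      neg-neg : ∀ x y → - x * - y ≈ x * y
      neg-neg x y = trans (sym (-‿distribˡ-* x (- y)))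
        (trans (-‿cong (sym (-‿distribʳ-* x y))) (-‿involutive _))

  -- Two Laplace expansions give a sum over ordered pairs of distinct columns; equality of the rows
  -- makes the product of the two entries symmetric, as `cancelling-pairs` requires.
  det-equal-first-rows : ∀ n (A : Matrix (2 ℕ.+ n) (2 ℕ.+ n)) → A zero ≋ A (suc zero) →
                         det (2 ℕ.+ n) A ≈ 0#
  det-equal-first-rows n A e = trans (∑-cong expand) (∑∑-cancelling (suc n) _
      (cancelling-pairs n (λ a b → A zero a * A zero b) (λ a b → *-comm _ _)
        (λ f → det n (λ r c → A (suc (suc r)) (f c)))
        (λ f f′ e → det-cong n λ r c → reflexive (≡.cong (A (suc (suc r))) (e c)))))
    where
    expand : ∀ j → _ ≈ ∑ _
    expand j = trans (*-congˡ (*-∑ (A zero j) _)) (trans (*-∑ _ _) (∑-cong λ l → trans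
      (*-congˡ (*-congˡ (*-congˡ (*-congʳ (sym (e (punchIn j l)))))))
      (solve 5 (λ s a t b d → s :* (a :* (t :* (b :* d))) := (s :* t) :* ((a :* b) :* d))
        refl (sgn (toℕ j)) (A zero j) (sgn (toℕ l)) (A zero (punchIn j l)) _)))

  det-alternating : ∀ n (A : Matrix n n) i k → i ≢ k → A i ≋ A k → det n A ≈ 0#
  -- Polarisation: with u + v in both rows 1 and k + 2 the determinant vanishes.
  det-equal-first-row : ∀ n (A : Matrix (suc n) (suc n)) k → A zero ≋ A (suc k) → det (suc n) A ≈ 0#
  det-equal-later-rows : ∀ n (A : Matrix (suc n) (suc n)) i k → i ≢ k → A (suc i) ≋ A (suc k) →
                         det (suc n) A ≈ 0#

  det-alternating (suc n) A zero    zero    i≢k e = contradiction ≡.refl i≢k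
  det-alternating (suc n) A zero    (suc k) i≢k e = det-equal-first-row n A k e
  det-alternating (suc n) A (suc i) zero    i≢k e = det-equal-first-row n A i (λ j → sym (e j))
  det-alternating (suc n) A (suc i) (suc k) i≢k e =
    det-equal-later-rows n A i k (i≢k ∘ ≡.cong suc) e

  det-equal-later-rows n A i k i≢k e = trans (∑-cong λ j → trans (*-congˡ (trans
    (*-congˡ (det-alternating n _ i k i≢k (λ c → e (punchIn j c)))) (zeroʳ _))) (zeroʳ _)) (∑-0 (suc n))

  det-equal-first-row (suc n) A zero e = det-equal-first-rows n A e
  det-equal-first-row (suc (suc n)) A (suc k) e = begin
    det (3 ℕ.+ n) A                ≈⟨ det-cong (3 ℕ.+ n) A≈C ⟩
    det (3 ℕ.+ n) (C u v)          ≈⟨ +-identityˡ _ ⟨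
    0# + det (3 ℕ.+ n) (C u v)     ≈⟨ +-congʳ (det-equal-later-rows (2 ℕ.+ n) (C u u) zero (suc k) (λ ())
                                        (λ j → sym (last u u j))) ⟨
    det (3 ℕ.+ n) (C u u) + det (3 ℕ.+ n) (C u v)
      ≈⟨ det-add (suc (suc k)) {C u u} {C u v} {C u w}
           (λ { zero _ j → refl ; (suc zero) _ j → refl ; (suc (suc r)) r≢k j → other r (r≢k ∘ ≡.cong (λ z → suc (suc z))) j })
           (λ { zero _ j → refl ; (suc zero) _ j → refl ; (suc (suc r)) r≢k j → other r (r≢k ∘ ≡.cong (λ z → suc (suc z))) j })
           (λ j → trans (last u w j) (sym (+-cong (last u u j) (last u v j)))) ⟨
    det (3 ℕ.+ n) (C u w)          ≈⟨ +-identityʳ _ ⟨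
    det (3 ℕ.+ n) (C u w) + 0#     ≈⟨ +-congˡ (det-equal-first-rows (suc n) (C v w) (λ j → refl)) ⟨
    det (3 ℕ.+ n) (C u w) + det (3 ℕ.+ n) (C v w)
      ≈⟨ det-add (suc zero) {C u w} {C v w} {C w w}
           (λ { zero _ j → refl ; (suc zero) h j → contradiction ≡.refl h ; (suc (suc r)) _ j → refl })
           (λ { zero _ j → refl ; (suc zero) h j → contradiction ≡.refl h ; (suc (suc r)) _ j → refl })
           (λ j → refl) ⟨
    det (3 ℕ.+ n) (C w w)          ≈⟨ det-equal-later-rows (2 ℕ.+ n) (C w w) zero (suc k) (λ ())
                                        (λ j → sym (last w w j)) ⟩
    0#                             ∎
    where
    u v w : Fin (3 ℕ.+ n) → Carrier
    u = A (suc zero)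
    v = A zero
    w j = u j + v j
    C : (x y : Fin (3 ℕ.+ n) → Carrier) → Matrix (3 ℕ.+ n) (3 ℕ.+ n)
    C x y = v ∷ x ∷ Vec.updateAt (λ i → A (suc (suc i))) k (λ _ → y)
    last : ∀ x y j → C x y (suc (suc k)) j ≈ y j
    last x y j = reflexive (≡.cong (λ r → r j) (Vec.updateAt-updates k (λ i → A (suc (suc i)))))
    minimal : ∀ x r → r ≢ k → ∀ j → Vec.updateAt (λ i → A (suc (suc i))) k (λ _ → x) r j ≈ A (suc (suc r)) j
    minimal x r r≢k j = reflexive (≡.cong (λ z → z j) (Vec.updateAt-minimal r k (λ i → A (suc (suc i))) r≢k))
    other : ∀ {x y} r → r ≢ k → ∀ j →
            Vec.updateAt (λ i → A (suc (suc i))) k (λ _ → x) r j ≈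
            Vec.updateAt (λ i → A (suc (suc i))) k (λ _ → y) r j
    other {x} {y} r r≢k j = trans (minimal x r r≢k j) (sym (minimal y r r≢k j))
    A≈C : ∀ i → A i ≋ C u v i
    A≈C zero       j = refl
    A≈C (suc zero) j = refl
    A≈C (suc (suc r)) j with r Fin.≟ k
    ... | yes ≡.refl = trans (sym (e j)) (sym (last u v j))
    ... | no  r≢k    = sym (minimal v r r≢k j)
    det-add : ∀ i {A B C : Matrix (3 ℕ.+ n) (3 ℕ.+ n)} → (∀ k → k ≢ i → A k ≋ C k) →
              (∀ k → k ≢ i → B k ≋ C k) → (∀ j → C i j ≈ A i j + B i j) →
              det (3 ℕ.+ n) C ≈ det (3 ℕ.+ n) A + det (3 ℕ.+ n) B
    det-add i a b e = trans
      (det-linear (3 ℕ.+ n) i 1# 1# a b λ j → trans (e j) (sym (+-cong (*-identityˡ _) (*-identityˡ _))))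
      (+-cong (*-identityˡ _) (*-identityˡ _))

  det-isAlternating : ∀ n → Alternating (det n)
  det-isAlternating n = record
    { cong = det-cong n ; linear = det-linear n ; alternating = det-alternating n _ }

-- Uniqueness of alternating forms and multiplicativity of the determinant

module DeterminantProduct {c ℓ} (R : CommutativeRing c ℓ) where
  open CommutativeRing R hiding (zero)
  open RingProperties ring using (-‿distribˡ-*; +-inverseˡ-unique)
  open Sums R
  open Determinant R
  open SemiringSolver commutativeSemiring using (solve; _:+_; _:*_; _:=_)
  open import Relation.Binary.Reasoning.Setoid setoid

  module _ {m n : ℕ} {Φ : Matrix (suc m) n → Carrier} (alt : Alternating Φ) where
    open Alternating alt

    private
      at-first : ∀ {u v : Fin n → Carrier} {T : Matrix m n} → ∀ k → k ≢ zero → (u ∷ T) k ≋ (v ∷ T) k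
      at-first zero    k≢0 = contradiction ≡.refl k≢0
      at-first (suc k) _ j = refl

    first-row-∑ : ∀ N (x : Fin N → Carrier) (u : Fin N → Fin n → Carrier) (T : Matrix m n) →
                  Φ ((λ j → ∑ (λ t → x t * u t j)) ∷ T) ≈ ∑ (λ t → x t * Φ (u t ∷ T))
    first-row-∑ zero x u T = begin
      -- The empty combination is the zero row, and linearity with both coefficients 0 gives the
      -- form the value 0 there.
      Φ (z ∷ T)                          ≈⟨ linear zero 0# 0# {z ∷ T} {z ∷ T} at-first at-first (λ j → trans (∑-zero _)
                                              (sym (trans (+-cong (zeroˡ _) (zeroˡ _)) (+-identityˡ _)))) ⟩
      0# * Φ (z ∷ T) + 0# * Φ (z ∷ T)    ≈⟨ +-cong (zeroˡ _) (zeroˡ _) ⟩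
      0# + 0#                            ≈⟨ +-identityˡ _ ⟩
      0#                                 ≈⟨ ∑-zero _ ⟨
      ∑ (λ t → x t * Φ (u t ∷ T))        ∎
      where
      z : Fin n → Carrier
      z j = ∑ (λ t → x t * u t j)
    first-row-∑ (suc N) x u T = begin
      Φ ((λ j → ∑ (λ t → x t * u t j)) ∷ T)
        ≈⟨ linear zero (x zero) 1# {u zero ∷ T} {z ∷ T} at-first at-first
             (λ j → trans (∑-suc _) (+-congˡ (sym (*-identityˡ _)))) ⟩
      x zero * Φ (u zero ∷ T) + 1# * Φ (z ∷ T)
        ≈⟨ +-congˡ (trans (*-identityˡ _) (first-row-∑ N (x ∘ suc) (u ∘ suc) T)) ⟩
      x zero * Φ (u zero ∷ T) + ∑ (λ t → x (suc t) * Φ (u (suc t) ∷ T))  ≈⟨ ∑-suc _ ⟨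
      ∑ (λ t → x t * Φ (u t ∷ T))        ∎
      where
      z : Fin n → Carrier
      z j = ∑ (λ t → x (suc t) * u (suc t) j)

    tail-isAlternating : ∀ v → Alternating (λ T → Φ (v ∷ T))
    tail-isAlternating v = record
      { cong        = λ h → cong λ { zero j → refl ; (suc i) → h i }
      ; linear      = λ i x y a b e → linear (suc i) x y
          (λ { zero _ j → refl ; (suc k) k≢i → a k (k≢i ∘ ≡.cong suc) })
          (λ { zero _ j → refl ; (suc k) k≢i → b k (k≢i ∘ ≡.cong suc) }) e
      ; alternating = λ i k i≢k e → alternating (suc i) (suc k) (i≢k ∘ Fin.suc-injective) e
      }

  -- Expand the form with u + v in both of the first two rows; the terms with a repeated row vanish.
  swap-first-rows : ∀ {m n} {Φ : Matrix (2 ℕ.+ m) n → Carrier} → Alternating Φ →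
                    ∀ u v T → Φ (u ∷ v ∷ T) ≈ - Φ (v ∷ u ∷ T)
  swap-first-rows {m} {n} {Φ} alt u v T = +-inverseˡ-unique _ _ (begin
    Φ (u ∷ v ∷ T) + Φ (v ∷ u ∷ T)
      ≈⟨ +-cong (+-identityˡ _) (+-identityʳ _) ⟨
    (0# + Φ (u ∷ v ∷ T)) + (Φ (v ∷ u ∷ T) + 0#)
      ≈⟨ +-cong (+-congʳ (diagonal u)) (+-congˡ (diagonal v)) ⟨
    (Φ (u ∷ u ∷ T) + Φ (u ∷ v ∷ T)) + (Φ (v ∷ u ∷ T) + Φ (v ∷ v ∷ T))
      ≈⟨ +-cong (second u) (second v) ⟨
    Φ (u ∷ w ∷ T) + Φ (v ∷ w ∷ T)
      ≈⟨ additive zero {u ∷ w ∷ T} {v ∷ w ∷ T}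
           (λ { zero h → contradiction ≡.refl h ; (suc k) _ j → refl })
           (λ { zero h → contradiction ≡.refl h ; (suc k) _ j → refl }) (λ j → refl) ⟨
    Φ (w ∷ w ∷ T)   ≈⟨ diagonal w ⟩
    0#              ∎)
    where
    open Alternating alt
    w : Fin n → Carrier
    w j = u j + v j
    diagonal : ∀ a → Φ (a ∷ a ∷ T) ≈ 0#
    diagonal a = alternating zero (suc zero) (λ ()) (λ j → refl)
    second : ∀ a → Φ (a ∷ w ∷ T) ≈ Φ (a ∷ u ∷ T) + Φ (a ∷ v ∷ T)
    second a = additive (suc zero) {a ∷ u ∷ T} {a ∷ v ∷ T}
      (λ { zero _ j → refl ; (suc zero) h → contradiction ≡.refl h ; (suc (suc k)) _ j → refl })
      (λ { zero _ j → refl ; (suc zero) h → contradiction ≡.refl h ; (suc (suc k)) _ j → refl })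
      (λ j → refl)

  -- Bringing row j to the top takes j transpositions of neighbours, each of which changes the sign.
  move-to-front : ∀ {m n} {Φ : Matrix (suc m) n → Carrier} → Alternating Φ →
                  ∀ j (u : Matrix (suc m) n) → Φ (u j ∷ u ∘ punchIn j) ≈ sgn (toℕ j) * Φ u
  move-to-front alt zero u =
    trans (Alternating.cong alt λ { zero c → refl ; (suc i) c → refl }) (sym (*-identityˡ _))
  move-to-front {suc m} {n} {Φ} alt (suc j) u = begin
    Φ (u (suc j) ∷ u ∘ punchIn (suc j))
      ≈⟨ Alternating.cong alt (λ { zero c → refl ; (suc zero) c → refl ; (suc (suc i)) c → refl }) ⟩
    Φ (u (suc j) ∷ u zero ∷ u ∘ suc ∘ punchIn j)      ≈⟨ swap-first-rows alt _ _ _ ⟩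
    - Φ (u zero ∷ u (suc j) ∷ u ∘ suc ∘ punchIn j)
      ≈⟨ -‿cong (move-to-front (tail-isAlternating alt (u zero)) j (u ∘ suc)) ⟩
    - (sgn (toℕ j) * Φ (u zero ∷ u ∘ suc))            ≈⟨ -‿distribˡ-* _ _ ⟩
    - sgn (toℕ j) * Φ (u zero ∷ u ∘ suc)
      ≈⟨ *-congˡ (Alternating.cong alt λ { zero c → refl ; (suc i) c → refl }) ⟩
    - sgn (toℕ j) * Φ u                               ∎

  -- Rows are exchanged one at a time. The intermediate matrices mix rows of X and Y, so the
  -- hypothesis is asked for all A and B that agree off row i.
  replace-rows : ∀ {m n} (Φ : Matrix m n → Carrier) →
    (∀ {A B} → (∀ i → A i ≋ B i) → Φ A ≈ Φ B) → (X Y : Matrix m n) →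
    (∀ i A B → (∀ k → k ≢ i → A k ≋ B k) → A i ≋ X i → B i ≋ Y i → Φ A ≈ Φ B) → Φ X ≈ Φ Y
  replace-rows {zero}  Φ Φ-cong X Y h = Φ-cong λ ()
  replace-rows {suc m} Φ Φ-cong X Y h = begin
    Φ X                    ≈⟨ h zero X (Y zero ∷ X ∘ suc)
                                (λ { zero 0≢0 → contradiction ≡.refl 0≢0 ; (suc k) _ j → refl })
                                (λ j → refl) (λ j → refl) ⟩
    Φ (Y zero ∷ X ∘ suc)   ≈⟨ replace-rows (λ T → Φ (Y zero ∷ T))
                                (λ e → Φ-cong λ { zero j → refl ; (suc i) → e i }) (X ∘ suc) (Y ∘ suc)
                                (λ i A B e → h (suc i) (Y zero ∷ A) (Y zero ∷ B)
                                  λ { zero _ j → refl ; (suc k) k≢i → e k (k≢i ∘ ≡.cong suc) }) ⟩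
    Φ (Y zero ∷ Y ∘ suc)   ≈⟨ Φ-cong (λ { zero j → refl ; (suc i) j → refl }) ⟩
    Φ Y                    ∎

  private
    ins : ∀ {n} → Fin (suc n) → (Fin n → Carrier) → Fin (suc n) → Carrier
    ins j v = Vec.insertAt v j 0#

    ins-at : ∀ {n} (j : Fin (suc n)) v → ins j v j ≈ 0#
    ins-at j v = reflexive (Vec.insertAt-lookup v j 0#)

    ins-punchIn : ∀ {n} (j : Fin (suc n)) v k → ins j v (punchIn j k) ≈ v k
    ins-punchIn j v k = reflexive (Vec.insertAt-punchIn v j 0# k)

  module _ {n} {Φ : Matrix (suc n) (suc n) → Carrier} (alt : Alternating Φ) (j : Fin (suc n)) where
    open Alternating alt

    -- A minor is filled up to a full matrix by a zero column at j below the first row `I j`. As a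
    -- function of the minor the form stays alternating, so the induction of `alternating-unique`
    -- applies to it.
    minor-isAlternating : Alternating (λ B → Φ (I j ∷ ins j ∘ B))
    minor-isAlternating = record
      { cong        = λ h → cong λ { zero _ → refl ; (suc i) → ins-cong (h i) }
      ; linear      = λ i x y {A} {B} {C} a b e → linear (suc i) x y
          (λ { zero _ _ → refl ; (suc k) k≢i → ins-cong (a k (k≢i ∘ ≡.cong suc)) })
          (λ { zero _ _ → refl ; (suc k) k≢i → ins-cong (b k (k≢i ∘ ≡.cong suc)) })
          (punchIn-cases _ j
            (trans (ins-at j _) (sym (trans (+-cong
              (trans (*-congˡ (ins-at j _)) (zeroʳ x)) (trans (*-congˡ (ins-at j _)) (zeroʳ y))) (+-identityˡ _))))
            (λ k → trans (ins-punchIn j _ k) (trans (e k)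
              (sym (+-cong (*-congˡ (ins-punchIn j _ k)) (*-congˡ (ins-punchIn j _ k)))))))
      ; alternating = λ i k i≢k e → alternating (suc i) (suc k) (i≢k ∘ Fin.suc-injective) (ins-cong e)
      }
      where
      ins-cong : ∀ {v w} → v ≋ w → ins j v ≋ ins j w
      ins-cong {v} {w} h = punchIn-cases _ j (trans (ins-at j v) (sym (ins-at j w)))
        (λ k → trans (ins-punchIn j v k) (trans (h k) (sym (ins-punchIn j w k))))

    -- Subtracting T i j times the first row `I j` from row i clears its entry in column j; the
    -- correction term has the row `I j` twice and vanishes.
    clear-column : ∀ T → Φ (I j ∷ T) ≈ Φ (I j ∷ λ r → ins j (T r ∘ punchIn j))
    clear-column T = replace-rows (λ T → Φ (I j ∷ T))
      (λ e → cong λ { zero _ → refl ; (suc i) → e i }) T (λ r → ins j (T r ∘ punchIn j)) step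
      where
      step : ∀ i A B → (∀ k → k ≢ i → A k ≋ B k) → A i ≋ T i → B i ≋ ins j (T i ∘ punchIn j) →
             Φ (I j ∷ A) ≈ Φ (I j ∷ B)
      step i A B e a b = begin
        Φ (I j ∷ A)                               ≈⟨ linear (suc i) 1# (T i j) {I j ∷ B} {I j ∷ C}
          (λ { zero _ _ → refl ; (suc k) k≢i c → sym (e k (k≢i ∘ ≡.cong suc) c) })
          (λ { zero _ _ → refl ; (suc k) k≢i c → trans (reflexive (≡.cong (λ z → z c)
                 (Vec.updateAt-minimal k i B (k≢i ∘ ≡.cong suc)))) (sym (e k (k≢i ∘ ≡.cong suc) c)) })
          (λ c → trans (a c) (trans (row c) (+-cong (trans (sym (b c)) (sym (*-identityˡ _)))
                 (*-congˡ (sym (Cᵢ c)))))) ⟩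
        1# * Φ (I j ∷ B) + T i j * Φ (I j ∷ C)    ≈⟨ +-cong (*-identityˡ _) (trans (*-congˡ
                                                       (alternating zero (suc i) (λ ()) (λ c → sym (Cᵢ c)))) (zeroʳ _)) ⟩
        Φ (I j ∷ B) + 0#                          ≈⟨ +-identityʳ _ ⟩
        Φ (I j ∷ B)                               ∎
        where
        C : Matrix n (suc n)
        C = Vec.updateAt B i (λ _ → I j)
        Cᵢ : C i ≋ I j
        Cᵢ c = reflexive (≡.cong (λ z → z c) (Vec.updateAt-updates i B))
        row : ∀ c → T i c ≈ ins j (T i ∘ punchIn j) c + T i j * I j c
        row = punchIn-cases _ j
          (sym (trans (+-cong (ins-at j _) (trans (*-congˡ (diag-≡ _ j)) (*-identityʳ _))) (+-identityˡ _)))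
          (λ k → sym (trans (+-cong (ins-punchIn j _ k)
             (trans (*-congˡ (diag-≢ _ (Fin.punchInᵢ≢i j k ∘ ≡.sym))) (zeroʳ _))) (+-identityʳ _)))

  -- Expand the first row in unit vectors `I j`, clear column j below, and apply the induction to
  -- the minor that is left. What remains is the identity with row j on top; moving that row back
  -- supplies the Laplace sign.
  alternating-unique : ∀ n {Φ : Matrix n n → Carrier} → Alternating Φ → ∀ A → Φ A ≈ det n A * Φ I
  alternating-unique zero    alt A = trans (Alternating.cong alt λ ()) (sym (*-identityˡ _))
  alternating-unique (suc n) {Φ} alt A = begin
    Φ A
      ≈⟨ cong (λ { zero c → sym (trans (∑-single c λ j j≢c → trans (*-congˡ (diag-≢ _ j≢c)) (zeroʳ _))
                              (trans (*-congˡ (diag-≡ _ c)) (*-identityʳ _)))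
                 ; (suc i) c → refl }) ⟩
    Φ ((λ c → ∑ (λ j → A zero j * I j c)) ∷ A ∘ suc)
      ≈⟨ first-row-∑ alt (suc n) (A zero) I (A ∘ suc) ⟩
    ∑ (λ j → A zero j * Φ (I j ∷ A ∘ suc))            ≈⟨ ∑-cong term ⟩
    ∑ (λ j → (sgn (toℕ j) * (A zero j * minor j)) * Φ I) ≈⟨ ∑-* _ _ ⟨
    det (suc n) A * Φ I                               ∎
    where
    open Alternating alt
    minor : Fin (suc n) → Carrier
    minor j = det n (λ r c → A (suc r) (punchIn j c))
    ins-I : ∀ j r → ins j (I r) ≋ I (punchIn j r)
    ins-I j r = punchIn-cases _ j
      (trans (ins-at j _) (sym (diag-≢ _ (Fin.punchInᵢ≢i j r)))) (λ k → trans (ins-punchIn j _ k) (I-punchIn k))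
      where
      I-punchIn : ∀ k → I r k ≈ I (punchIn j r) (punchIn j k)
      I-punchIn k with r Fin.≟ k
      ... | yes ≡.refl = sym (diag-≡ _ (punchIn j r))
      ... | no  r≢k    = sym (diag-≢ _ (r≢k ∘ Fin.punchIn-injective j r k))
    term : ∀ j → A zero j * Φ (I j ∷ A ∘ suc) ≈ (sgn (toℕ j) * (A zero j * minor j)) * Φ I
    term j = begin
      A zero j * Φ (I j ∷ A ∘ suc)
        ≈⟨ *-congˡ (clear-column alt j (A ∘ suc)) ⟩
      A zero j * Φ (I j ∷ λ r → ins j (A (suc r) ∘ punchIn j))
        ≈⟨ *-congˡ (alternating-unique n (minor-isAlternating alt j) (λ r → A (suc r) ∘ punchIn j)) ⟩
      A zero j * (minor j * Φ (I j ∷ ins j ∘ I))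
        ≈⟨ *-congˡ (*-congˡ (cong λ { zero c → refl ; (suc r) → ins-I j r })) ⟩
      A zero j * (minor j * Φ (I j ∷ I ∘ punchIn j))
        ≈⟨ *-congˡ (*-congˡ (move-to-front alt j I)) ⟩
      A zero j * (minor j * (sgn (toℕ j) * Φ I))
        ≈⟨ solve 4 (λ a m s p → a :* (m :* (s :* p)) := (s :* (a :* m)) :* p) refl _ _ _ _ ⟩
      (sgn (toℕ j) * (A zero j * minor j)) * Φ I ∎

  infixl 7 _⊙_
  _⊙_ : ∀ {k m n} → Matrix k m → Matrix m n → Matrix k n
  (A ⊙ B) i j = ∑ (λ t → A i t * B t j)

  ⊙-isAlternating : ∀ {m n k} (B : Matrix n k) {Φ : Matrix m k → Carrier} →
                    Alternating Φ → Alternating (λ A → Φ (A ⊙ B))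
  ⊙-isAlternating {m} {n} {k} B alt = record
    { cong        = λ h → cong λ i → ⊙-row (h i)
    ; linear      = λ i x y a b e → linear i x y (λ k k≢i → ⊙-row (a k k≢i)) (λ k k≢i → ⊙-row (b k k≢i))
        λ j → trans (∑-cong λ t → trans (*-congʳ (e t))
          (solve 5 (λ x a y b c → (x :* a :+ y :* b) :* c := x :* (a :* c) :+ y :* (b :* c)) refl x _ y _ _))
          (trans (∑-+ _ _) (sym (+-cong (*-∑ x _) (*-∑ y _))))
    ; alternating = λ i k i≢k e → alternating i k i≢k (⊙-row e)
    }
    where
    open Alternating alt
    ⊙-row : ∀ {v w : Fin n → Carrier} → v ≋ w → (λ j → ∑ (λ t → v t * B t j)) ≋ (λ j → ∑ (λ t → w t * B t j))
    ⊙-row e j = ∑-cong λ t → *-congʳ (e t)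

  -- For fixed B the map from A to det (A B) is alternating and takes the value det B at the
  -- identity.
  det-⊙ : ∀ {n} (A B : Matrix n n) → det n (A ⊙ B) ≈ det n A * det n B
  det-⊙ {n} A B = trans (alternating-unique n (⊙-isAlternating B (det-isAlternating n)) A)
    (*-congˡ (det-cong n λ i j → trans (∑-single i λ t t≢i → trans (*-congʳ (diag-≢ _ (t≢i ∘ ≡.sym))) (zeroˡ _))
      (trans (*-congʳ (diag-≡ _ i)) (*-identityˡ _))))

  det-diag : ∀ {n} (d : Fin n → Carrier) → det n (diag d) ≈ ∏ d
  det-diag {zero}  d = sym (∏-zero d)
  det-diag {suc n} d = begin
    det (suc n) (diag d)
      ≈⟨ ∑-single zero (λ j j≢0 → trans (*-congˡ (trans (*-congʳ (diag-≢ d (j≢0 ∘ ≡.sym))) (zeroˡ _))) (zeroʳ _)) ⟩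
    1# * (d zero * det n (λ r c → diag d (suc r) (suc c)))
      ≈⟨ trans (*-identityˡ _) (*-congˡ (det-cong n λ r c → refl)) ⟩
    d zero * det n (diag (d ∘ suc))     ≈⟨ *-congˡ (det-diag (d ∘ suc)) ⟩
    d zero * ∏ (d ∘ suc)                ≈⟨ ∏-suc d ⟨
    ∏ d                                 ∎

-- The ring ℤ[w]: interface and construction

record CyclotomicIntegers (p : ℕ) : Set₁ where
  field
    commutativeRing : CommutativeRing 0ℓ 0ℓ
  open CommutativeRing commutativeRing hiding (zero)
  open Sums commutativeRing using (∑; _^_)
  field
    ι            : ℤ → Carrier
    ι-+          : ∀ a b → ι (a ℤ.+ b) ≈ ι a + ι b
    ι-*          : ∀ a b → ι (a ℤ.* b) ≈ ι a * ι b
    ι-0          : ι (+ 0) ≈ 0#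
    ι-1          : ι (+ 1) ≈ 1#
    ι-neg        : ∀ a → ι (ℤ.- a) ≈ - ι a
    w            : Carrier
    geometric    : ∑ {p} (λ k → w ^ toℕ k) ≈ 0#
    torsion-free : ∀ {x} → ι (+ p) * x ≈ 0# → x ≈ 0#
    ι-∣          : ∀ {m q x} → ι m ≈ ι q * x → q ℤ.∣ m

-- ℤ[X] / (1 + X + ⋯ + X^(p-1)), with polynomials acting as shift operators on
-- the integer sequences annihilated by 1 + X + ⋯ + X^(p-1).
module ShiftOperators (m : ℕ) where
  open import Data.Integer using (_+_; _*_; -_; _-_)

  p : ℕ
  p = 2 ℕ.+ m

  infixl 6 _⊕_
  infixl 7 _⊗_
  -- Syntax instead of arbitrary maps on sequences: linearity and commutation of any two operators
  -- then follow by induction.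
  data Op : Set where
    con     : ℤ → Op
    X       : Op
    _⊕_ _⊗_ : Op → Op → Op

  ⟦_⟧ : Op → (ℕ → ℤ) → ℕ → ℤ
  ⟦ con c ⟧ s n = c * s n
  ⟦ X ⟧     s n = s (suc n)
  ⟦ a ⊕ b ⟧ s n = ⟦ a ⟧ s n + ⟦ b ⟧ s n
  ⟦ a ⊗ b ⟧ s n = ⟦ a ⟧ (⟦ b ⟧ s) n

  ⟦⟧-cong : ∀ a {s t} → (∀ n → s n ≡ t n) → ∀ n → ⟦ a ⟧ s n ≡ ⟦ a ⟧ t n
  ⟦⟧-cong (con c) e n = ≡.cong (c *_) (e n)
  ⟦⟧-cong X       e n = e (suc n)
  ⟦⟧-cong (a ⊕ b) e n = ≡.cong₂ _+_ (⟦⟧-cong a e n) (⟦⟧-cong b e n)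
  ⟦⟧-cong (a ⊗ b) e n = ⟦⟧-cong a (⟦⟧-cong b e) n

  ⟦⟧-+ : ∀ a s t n → ⟦ a ⟧ (λ k → s k + t k) n ≡ ⟦ a ⟧ s n + ⟦ a ⟧ t n
  ⟦⟧-+ (con c) s t n = ℤ.*-distribˡ-+ c (s n) (t n)
  ⟦⟧-+ X       s t n = ≡.refl
  ⟦⟧-+ (a ⊕ b) s t n = ≡.trans (≡.cong₂ _+_ (⟦⟧-+ a s t n) (⟦⟧-+ b s t n)) (interchange (⟦ a ⟧ s n) (⟦ a ⟧ t n) (⟦ b ⟧ s n) (⟦ b ⟧ t n))
    where
    interchange : ∀ a b c d → (a + b) + (c + d) ≡ (a + c) + (b + d)
    interchange = solve-∀
  ⟦⟧-+ (a ⊗ b) s t n = ≡.trans (⟦⟧-cong a (⟦⟧-+ b s t) n) (⟦⟧-+ a (⟦ b ⟧ s) (⟦ b ⟧ t) n)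

  ⟦⟧-* : ∀ a c s n → ⟦ a ⟧ (λ k → c * s k) n ≡ c * ⟦ a ⟧ s n
  ⟦⟧-* (con d) c s n = swap d c (s n)
    where
    swap : ∀ d c x → d * (c * x) ≡ c * (d * x)
    swap = solve-∀
  ⟦⟧-* X       c s n = ≡.refl
  ⟦⟧-* (a ⊕ b) c s n = ≡.trans (≡.cong₂ _+_ (⟦⟧-* a c s n) (⟦⟧-* b c s n))
    (≡.sym (ℤ.*-distribˡ-+ c (⟦ a ⟧ s n) (⟦ b ⟧ s n)))
  ⟦⟧-* (a ⊗ b) c s n = ≡.trans (⟦⟧-cong a (⟦⟧-* b c s) n) (⟦⟧-* a c (⟦ b ⟧ s) n)

  ⟦⟧-shift : ∀ a s n → ⟦ a ⟧ (s ∘ suc) n ≡ ⟦ a ⟧ s (suc n)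
  ⟦⟧-shift (con c) s n = ≡.refl
  ⟦⟧-shift X       s n = ≡.refl
  ⟦⟧-shift (a ⊕ b) s n = ≡.cong₂ _+_ (⟦⟧-shift a s n) (⟦⟧-shift b s n)
  ⟦⟧-shift (a ⊗ b) s n = ≡.trans (⟦⟧-cong a (⟦⟧-shift b s) n) (⟦⟧-shift a (⟦ b ⟧ s) n)

  ⟦⟧-comm : ∀ a b s n → ⟦ a ⟧ (⟦ b ⟧ s) n ≡ ⟦ b ⟧ (⟦ a ⟧ s) n
  ⟦⟧-comm (con c)  b s n = ≡.sym (⟦⟧-* b c s n)
  ⟦⟧-comm X        b s n = ≡.sym (⟦⟧-shift b s n)
  ⟦⟧-comm (a ⊕ a′) b s n = ≡.trans (≡.cong₂ _+_ (⟦⟧-comm a b s n) (⟦⟧-comm a′ b s n))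
    (≡.sym (⟦⟧-+ b (⟦ a ⟧ s) (⟦ a′ ⟧ s) n))
  ⟦⟧-comm (a ⊗ a′) b s n = ≡.trans (⟦⟧-cong a (⟦⟧-comm a′ b s) n) (⟦⟧-comm a b (⟦ a′ ⟧ s) n)

  geo : ℕ → Op
  geo zero    = con (+ 0)
  geo (suc k) = con (+ 1) ⊕ X ⊗ geo k

  Annihilated : (ℕ → ℤ) → Set
  Annihilated s = ∀ n → ⟦ geo p ⟧ s n ≡ + 0

  -- Holds because operators commute. It makes multiplication respect `_≈_`: an equation between
  -- left factors is applied to the image of a sequence under the right factor.
  ⟦⟧-annihilated : ∀ a {s} → Annihilated s → Annihilated (⟦ a ⟧ s)
  ⟦⟧-annihilated a {s} e n = ≡.trans (⟦⟧-comm (geo p) a s n)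
    (≡.trans (⟦⟧-cong a e n) (⟦⟧-* a (+ 0) (λ _ → + 0) n))

  infix 4 _≈_
  record _≈_ (a b : Op) : Set where
    constructor mk
    field at : ∀ s → Annihilated s → ∀ n → ⟦ a ⟧ s n ≡ ⟦ b ⟧ s n
  open _≈_

  commutativeRing : CommutativeRing 0ℓ 0ℓ
  commutativeRing = record
    { Carrier = Op ; _≈_ = _≈_ ; _+_ = _⊕_ ; _*_ = _⊗_ ; -_ = con (- (+ 1)) ⊗_
    ; 0# = con (+ 0) ; 1# = con (+ 1)
    ; isCommutativeRing = record
      { isRing = record
        { +-isAbelianGroup = record
          { isGroup = record
            { isMonoid = record
              { isSemigroup = record
                { isMagma = record
                  { isEquivalence = record
                    { refl  = mk λ s e n → ≡.refl
                    ; sym   = λ h → mk λ s e n → ≡.sym (at h s e n)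
                    ; trans = λ h k → mk λ s e n → ≡.trans (at h s e n) (at k s e n)
                    }
                  ; ∙-cong = λ h k → mk λ s e n → ≡.cong₂ _+_ (at h s e n) (at k s e n)
                  }
                ; assoc = λ a b c → mk λ s e n → ℤ.+-assoc (⟦ a ⟧ s n) (⟦ b ⟧ s n) (⟦ c ⟧ s n)
                }
              ; identity = (λ a → mk λ s e n → ℤ.+-identityˡ (⟦ a ⟧ s n))
                         , (λ a → mk λ s e n → ℤ.+-identityʳ (⟦ a ⟧ s n))
              }
            ; inverse = (λ a → mk λ s e n → neg-+ (⟦ a ⟧ s n))
                      , (λ a → mk λ s e n → +-neg (⟦ a ⟧ s n))
            ; ⁻¹-cong = λ h → mk λ s e n → ≡.cong (- (+ 1) *_) (at h s e n)
            }
          ; comm = λ a b → mk λ s e n → ℤ.+-comm (⟦ a ⟧ s n) (⟦ b ⟧ s n)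
          }
        ; *-cong = λ {a} {a′} {b} {b′} h k → mk λ s e n → ≡.trans
            (⟦⟧-cong a (at k s e) n) (at h (⟦ b′ ⟧ s) (⟦⟧-annihilated b′ e) n)
        ; *-assoc = λ a b c → mk λ s e n → ≡.refl
        ; *-identity = (λ a → mk λ s e n → ℤ.*-identityˡ (⟦ a ⟧ s n))
                     , (λ a → mk λ s e n → ≡.trans (⟦⟧-* a (+ 1) s n) (ℤ.*-identityˡ (⟦ a ⟧ s n)))
        ; distrib = (λ a b c → mk λ s e n → ⟦⟧-+ a (⟦ b ⟧ s) (⟦ c ⟧ s) n)
                  , (λ a b c → mk λ s e n → ≡.refl)
        }
      ; *-comm = λ a b → mk λ s e n → ⟦⟧-comm a b s n
      }
    }
    where
    neg-+ : ∀ x → - (+ 1) * x + x ≡ + 0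
    neg-+ = solve-∀
    +-neg : ∀ x → x + - (+ 1) * x ≡ + 0
    +-neg = solve-∀

  open CommutativeRing commutativeRing using (setoid; +-congˡ; *-congˡ; refl; sym; trans)
  open Sums commutativeRing using (∑; _^_; ∑-zero; ∑-suc; *-∑)

  ∑-X^ : ∀ k → ∑ {k} (λ i → X ^ toℕ i) ≈ geo k
  ∑-X^ zero    = ∑-zero _
  ∑-X^ (suc k) = trans (∑-suc _) (+-congˡ (trans (sym (*-∑ {k} X (λ i → X ^ toℕ i))) (*-congˡ (∑-X^ k))))

  private
    δ : ℕ → ℤ
    δ zero    = + 1
    δ (suc _) = + 0

    -- Here t is the indicator of the multiples of p, and s is 1, 0, ..., 0, -1 repeated with period
    -- p. The value at 0 of an operator applied to s is its constant coefficient in the basis 1, X,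
    -- ..., X^(p-2).
    t s : ℕ → ℤ
    t n = δ (n ℕ.% p)
    s n = t n - t (suc n)

  geo-difference : ∀ k n → ⟦ geo k ⟧ s n ≡ t n - t (k ℕ.+ n)
  geo-difference zero n = ≡.trans (ℤ.*-zeroˡ (s n)) (≡.sym (ℤ.+-inverseʳ (t n)))
  geo-difference (suc k) n rewrite geo-difference k (suc n) | ℕ.+-suc k n =
    telescope (t n) (t (suc n)) (t (suc (k ℕ.+ n)))
    where
    telescope : ∀ a b c → + 1 * (a - b) + (b - c) ≡ a - c
    telescope = solve-∀

  s-annihilated : Annihilated s
  s-annihilated n = ≡.trans (geo-difference p n) (≡.trans
    (≡.cong (λ r → t n - δ r) (≡.trans (≡.cong (ℕ._% p) (ℕ.+-comm p n)) (ℕ.[m+n]%n≡m%n n p)))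
    (ℤ.+-inverseʳ (t n)))

  s₀≡1 : s 0 ≡ + 1
  s₀≡1 rewrite ℕ.m<n⇒m%n≡m {n = p} (s<s z<s) = ≡.refl

  -- Evaluated at s and position 0, where s is 1, the equation becomes one between integers.
  con-∣ : ∀ {m q a} → con m ≈ con q ⊗ a → q ℤ.∣ m
  con-∣ {m} {q} {a} h = ℤˢ.∣⇒∣ᵤ (ℤˢ.divides (⟦ a ⟧ s 0) (≡.trans (≡.sym (ℤ.*-identityʳ m))
    (≡.trans (≡.cong (m *_) (≡.sym s₀≡1)) (≡.trans (at h s s-annihilated 0) (ℤ.*-comm q (⟦ a ⟧ s 0))))))

  cyclotomicIntegers : CyclotomicIntegers p
  cyclotomicIntegers = record
    { commutativeRing = commutativeRing
    ; ι = con
    ; ι-+ = λ a b → mk λ s e n → ℤ.*-distribʳ-+ (s n) a b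
    ; ι-* = λ a b → mk λ s e n → ℤ.*-assoc a b (s n)
    ; ι-0 = refl
    ; ι-1 = refl
    ; ι-neg = λ a → mk λ s e n → neg a (s n)
    ; w = X
    ; geometric = trans (∑-X^ p) (mk λ s e n → e n)
    -- Sequences have integer values, so p cancels at each position.
    ; torsion-free = λ {x} h → mk λ s e n → ℤ.*-cancelˡ-≡ (+ p) (⟦ x ⟧ s n) (+ 0) (≡.trans (at h s e n) (≡.sym (ℤ.*-zeroʳ (+ p))))
    ; ι-∣ = λ {m} {q} {x} → con-∣ {m} {q} {x}
    }
    where
    neg : ∀ a x → - a * x ≡ - (+ 1) * (a * x)
    neg = solve-∀

-- Primes, modular inverses and binomial coefficients

prime-∣-* : ∀ {p} → Prime p → ∀ a b → + p ℤ.∣ a ℤ.* b → (+ p ℤ.∣ a) ⊎ (+ p ℤ.∣ b)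
prime-∣-* {p} pr a b d = euclidsLemma ℤ.∣ a ∣ ℤ.∣ b ∣ pr (≡.subst (p ℕ.∣_) (ℤ.abs-* a b) d)

prime∤1 : ∀ {p} → Prime p → ¬ (p ℕ.∣ 1)
prime∤1 pr d = ¬prime[1] (≡.subst Prime (ℕ.∣1⇒≡1 d) pr)

prime-∣-^ : ∀ {p} → Prime p → ∀ a n → + p ℤ.∣ a ℤ.^ n → + p ℤ.∣ a
prime-∣-^ pr a zero    d = contradiction d (prime∤1 pr)
prime-∣-^ pr a (suc n) d with prime-∣-* pr a (a ℤ.^ n) d
... | inj₁ d′ = d′
... | inj₂ d′ = prime-∣-^ pr a n d′

prime∤⇒coprime : ∀ {p m} → Prime p → ¬ (p ℕ.∣ m) → Coprime.Coprime m p
prime∤⇒coprime pr p∤m (d∣m , d∣p) with prime⇒irreducible pr d∣p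
... | inj₁ d≡1    = d≡1
... | inj₂ ≡.refl = contradiction d∣m p∤m

opaque
  -- The congruence is kept in ℕ, with a multiple of p on either side, because it is applied to
  -- exponents of w.
  modular-inverse : ∀ {p m} → Prime p → ¬ (p ℕ.∣ m) →
                    ∃ λ m′ → ∃ λ a → ∃ λ b → m ℕ.* m′ ℕ.+ a ℕ.* p ≡ 1 ℕ.+ b ℕ.* p
  modular-inverse {p} {m} pr p∤m with Coprime.coprime-Bézout (prime∤⇒coprime pr p∤m)
  ... | GCD.Bézout.+- x y eq = x , 0 , y , ≡.trans (ℕ.+-identityʳ _) (≡.trans (ℕ.*-comm m x) (≡.sym eq))
  -- Here x m ≡ -1 modulo p, so x (m x) is an inverse of m: its product with m is (x m)².
  ... | GCD.Bézout.-+ x y eq = x ℕ.* (m ℕ.* x) , y , x ℕ.* m ℕ.* y , (begin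
      m ℕ.* (x ℕ.* (m ℕ.* x)) ℕ.+ y ℕ.* p              ≡⟨ ≡.cong (m ℕ.* (x ℕ.* (m ℕ.* x)) ℕ.+_) eq ⟨
      m ℕ.* (x ℕ.* (m ℕ.* x)) ℕ.+ (1 ℕ.+ x ℕ.* m)      ≡⟨ rearrange m x ⟩
      1 ℕ.+ x ℕ.* m ℕ.* (1 ℕ.+ x ℕ.* m)                ≡⟨ ≡.cong (λ z → 1 ℕ.+ x ℕ.* m ℕ.* z) eq ⟩
      1 ℕ.+ x ℕ.* m ℕ.* (y ℕ.* p)                      ≡⟨ ≡.cong suc (ℕ.*-assoc (x ℕ.* m) y p) ⟨
      1 ℕ.+ x ℕ.* m ℕ.* y ℕ.* p                        ∎)
    where
    open ≡.≡-Reasoning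
    rearrange : ∀ m x → m ℕ.* (x ℕ.* (m ℕ.* x)) ℕ.+ (1 ℕ.+ x ℕ.* m) ≡ 1 ℕ.+ x ℕ.* m ℕ.* (1 ℕ.+ x ℕ.* m)
    rearrange = ℕSolver.solve-∀

-- Coefficient of x ^ k in (1 - x) ^ n.
binomial : ℕ → ℕ → ℤ
binomial zero    zero    = + 1
binomial zero    (suc k) = + 0
binomial (suc n) zero    = binomial n zero
binomial (suc n) (suc k) = binomial n (suc k) ℤ.- binomial n k

module _ where
  open import Data.Integer using (_+_; _*_; -_; _-_)

  binomial-zeroʳ : ∀ n → binomial n 0 ≡ + 1
  binomial-zeroʳ zero    = ≡.refl
  binomial-zeroʳ (suc n) = binomial-zeroʳ n

  -- The absorption identity with the signs of (1 - x)^n. At n + 1 = p it lets Euclid's lemma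
  -- extract p from the inner coefficients.
  binomial-absorption : ∀ n k → + suc k * binomial (suc n) (suc k) ≡ - (+ suc n * binomial n k)
  binomial-absorption zero zero    = ≡.refl
  binomial-absorption zero (suc k) = ℤ.*-zeroʳ (+ suc (suc k))
  binomial-absorption (suc n) zero = begin
    + 1 * (binomial (suc n) 1 - x)     ≡⟨ distrib (binomial (suc n) 1) x ⟩
    + 1 * binomial (suc n) 1 - x       ≡⟨ ≡.cong (_- x) (binomial-absorption n 0) ⟩
    - (+ suc n * x) - x                ≡⟨ collect (+ suc n) x ⟩
    - ((+ 1 + + suc n) * x)            ∎
    where
    open ≡.≡-Reasoning
    x = binomial n 0
    distrib : ∀ y x → + 1 * (y - x) ≡ + 1 * y - x
    distrib = solve-∀
    collect : ∀ n x → - (n * x) - x ≡ - ((+ 1 + n) * x)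
    collect = solve-∀
  binomial-absorption (suc n) (suc k) = begin
    (+ 1 + + suc k) * (y - binomial (suc n) (suc k))  ≡⟨ distrib (+ suc k) y _ ⟩
    (+ 1 + + suc k) * y - + suc k * binomial (suc n) (suc k) - binomial (suc n) (suc k)
      ≡⟨ ≡.cong₂ (λ a b → a - b - binomial (suc n) (suc k))
           (binomial-absorption n (suc k)) (binomial-absorption n k) ⟩
    - (+ suc n * x) - - (+ suc n * x′) - (x - x′)     ≡⟨ collect (+ suc n) x x′ ⟩
    - ((+ 1 + + suc n) * (x - x′))                    ∎
    where
    open ≡.≡-Reasoning
    x  = binomial n (suc k)
    x′ = binomial n k
    y  = binomial (suc n) (suc (suc k))
    distrib : ∀ k y z → (+ 1 + k) * (y - z) ≡ (+ 1 + k) * y - k * z - z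
    distrib = solve-∀
    collect : ∀ n x x′ → - (n * x) - - (n * x′) - (x - x′) ≡ - ((+ 1 + n) * (x - x′))
    collect = solve-∀

  prime-∣-binomial : ∀ {q} → Prime (suc q) → ∀ k → k ℕ.< q → + suc q ℤ.∣ binomial (suc q) (suc k)
  prime-∣-binomial {q} pr k k<q with prime-∣-* pr (+ suc k) (binomial (suc q) (suc k))
    (ℤˢ.∣⇒∣ᵤ (ℤˢ.divides (- binomial q k) (≡.trans (binomial-absorption q k) (swap (+ suc q) _))))
    where
    swap : ∀ x y → - (x * y) ≡ - y * x
    swap = solve-∀
  ... | inj₁ d = contradiction (ℕ.∣⇒≤ d) (ℕ.<⇒≱ (s<s k<q))
  ... | inj₂ d = d

  -- By Pascal's rule, neighbouring coefficients of (1 - x)^(p-1) differ by an inner coefficient of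
  -- (1 - x)^p, which p divides; so all are congruent to the first.
  binomial-mod-prime : ∀ {q} → Prime (suc q) → ∀ k → k ℕ.≤ q →
                       ∃ λ c → binomial q k ≡ + 1 + + suc q * c
  binomial-mod-prime {q} pr zero    _   = + 0 , ≡.trans (binomial-zeroʳ q)
    (≡.cong (λ z → + 1 + z) (≡.sym (ℤ.*-zeroʳ (+ suc q))))
  binomial-mod-prime {q} pr (suc k) k<q with binomial-mod-prime pr k (ℕ.<⇒≤ k<q) | ℤˢ.∣ᵤ⇒∣ {+ suc q} {binomial (suc q) (suc k)} (prime-∣-binomial pr k k<q)
  ... | c , e | ℤˢ.divides d e′ = c + d , (begin
    binomial q (suc k)                           ≡⟨ split (binomial q (suc k)) (binomial q k) ⟩
    (binomial q (suc k) - binomial q k) + binomial q k  ≡⟨ ≡.cong₂ _+_ {u = binomial q k} e′ e ⟩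
    d * + suc q + (+ 1 + + suc q * c)            ≡⟨ collect d (+ suc q) c ⟩
    + 1 + + suc q * (c + d)                      ∎)
    where
    open ≡.≡-Reasoning
    split : ∀ x y → x ≡ (x - y) + y
    split = solve-∀
    collect : ∀ d p c → d * p + (+ 1 + p * c) ≡ + 1 + p * (c + d)
    collect = solve-∀

-- Powers of w and congruences in ℤ[w]

module Cyclotomic {p : ℕ} (K : CyclotomicIntegers p) where
  open CyclotomicIntegers K public
  open CommutativeRing commutativeRing public hiding (zero)
  open Sums commutativeRing public
  open import Relation.Binary.Reasoning.Setoid setoid

  -- Sends 0 and 1 to 0# and 1# on the nose, for the benefit of the ring solver.
  private
    coefficient : ℤ → Carrier
    coefficient (+ 0) = 0#
    coefficient (+ 1) = 1#
    coefficient c     = ι c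

    coefficient≈ι : ∀ c → coefficient c ≈ ι c
    coefficient≈ι (+ 0)             = sym ι-0
    coefficient≈ι (+ 1)             = sym ι-1
    coefficient≈ι (+ suc (suc n))   = refl
    coefficient≈ι (-[1+ n ])        = refl

    morphism : ℤ.+-*-rawRing -Raw-AlmostCommutative⟶ fromCommutativeRing commutativeRing
    morphism = record
      { ⟦_⟧    = coefficient
      ; +-homo = λ a b → trans (coefficient≈ι (a ℤ.+ b))
          (trans (ι-+ a b) (sym (+-cong (coefficient≈ι a) (coefficient≈ι b))))
      ; *-homo = λ a b → trans (coefficient≈ι (a ℤ.* b))
          (trans (ι-* a b) (sym (*-cong (coefficient≈ι a) (coefficient≈ι b))))
      ; -‿homo = λ a → trans (coefficient≈ι (ℤ.- a)) (trans (ι-neg a) (-‿cong (sym (coefficient≈ι a))))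
      ; 0-homo = refl
      ; 1-homo = refl
      }

    _coefficient≟_ : ∀ a b → Maybe (coefficient a ≈ coefficient b)
    a coefficient≟ b with a ℤ.≟ b
    ... | yes ≡.refl = just refl
    ... | no  _      = nothing

  open RingSolver ℤ.+-*-rawRing (fromCommutativeRing commutativeRing) morphism _coefficient≟_ public
    using (solve; con; _:=_; _:+_; _:*_; _:-_; :-_)

  ι-∑ : ∀ {n} (f : Fin n → ℤ) → ι (Defs.∑ f) ≈ ∑ (ι ∘ f)
  ι-∑ {zero}  f = trans ι-0 (sym (∑-zero _))
  ι-∑ {suc n} f = trans (ι-+ _ _) (trans (+-congˡ (ι-∑ (f ∘ suc))) (sym (∑-suc _)))

  ι-^ : ∀ a k → ι (a ℤ.^ k) ≈ ι a ^ k
  ι-^ a zero    = ι-1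
  ι-^ a (suc k) = trans (ι-* _ _) (*-congˡ (ι-^ a k))

  ι-ℕ^ : ∀ a k → ι (+ (a ℕ.^ k)) ≈ ι (+ a) ^ k
  ι-ℕ^ a zero    = ι-1
  ι-ℕ^ a (suc k) = trans (trans (reflexive (≡.cong ι (ℤ.pos-* a (a ℕ.^ k)))) (ι-* _ _)) (*-congˡ (ι-ℕ^ a k))

  ι-suc : ∀ n → ι (+ suc n) ≈ 1# + ι (+ n)
  ι-suc n = trans (ι-+ (+ 1) (+ n)) (+-congʳ ι-1)

  1^ : ∀ n → 1# ^ n ≈ 1#
  1^ zero    = refl
  1^ (suc n) = trans (*-identityˡ _) (1^ n)

  *-^ : ∀ n x y → (x * y) ^ n ≈ x ^ n * y ^ n
  *-^ zero    x y = sym (*-identityˡ _)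
  *-^ (suc n) x y = trans (*-congˡ (*-^ n x y))
    (solve 4 (λ x y a b → (x :* y) :* (a :* b) := (x :* a) :* (y :* b)) refl _ _ _ _)

  ∑-1 : ∀ n → ∑ {n} (λ _ → 1#) ≈ ι (+ n)
  ∑-1 zero    = trans (∑-zero _) (sym ι-0)
  ∑-1 (suc n) = trans (∑-suc _) (trans (+-congˡ (∑-1 n)) (sym (ι-suc n)))

  Regular : Carrier → Set
  Regular x = ∀ {y} → x * y ≈ 0# → y ≈ 0#

  regular-cancel : ∀ {x y z} → Regular x → x * y ≈ x * z → y ≈ z
  regular-cancel {x} {y} {z} r e = begin
    y            ≈⟨ solve 2 (λ y z → y := (y :- z) :+ z) refl y z ⟩
    (y - z) + z  ≈⟨ +-congʳ (r (begin
      x * (y - z)    ≈⟨ solve 3 (λ x y z → x :* (y :- z) := x :* y :- x :* z) refl x y z ⟩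
      x * y - x * z  ≈⟨ +-congʳ e ⟩
      x * z - x * z  ≈⟨ -‿inverseʳ _ ⟩
      0#             ∎)) ⟩
    0# + z       ≈⟨ +-identityˡ z ⟩
    z            ∎

  regular-≈ : ∀ {x y} → x ≈ y → Regular x → Regular y
  regular-≈ e r h = r (trans (*-congʳ e) h)

  regular-* : ∀ {x y} → Regular x → Regular y → Regular (x * y)
  regular-* r s h = s (r (trans (sym (*-assoc _ _ _)) h))

  regular-∏ : ∀ {n} {f : Fin n → Carrier} → (∀ i → Regular (f i)) → Regular (∏ f)
  regular-∏ {zero}  r h = trans (sym (*-identityˡ _)) (trans (*-congʳ (sym (∏-zero _))) h)
  regular-∏ {suc n} r = regular-≈ (sym (∏-suc _)) (regular-* (r zero) (regular-∏ (r ∘ suc)))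

  regular-^ : ∀ {x} n → Regular x → Regular (x ^ n)
  regular-^ zero    r h = trans (sym (*-identityˡ _)) h
  regular-^ (suc n) r = regular-* r (regular-^ n r)

  geometric-sum : ∀ n x → x ^ n + (1# - x) * ∑ {n} (λ k → x ^ toℕ k) ≈ 1#
  geometric-sum zero    x = trans (+-congˡ (trans (*-congˡ (∑-zero _)) (zeroʳ _))) (+-identityʳ _)
  geometric-sum (suc n) x = begin
    x * x ^ n + (1# - x) * ∑ {suc n} (λ k → x ^ toℕ k)
      ≈⟨ +-congˡ (*-congˡ (trans (∑-suc _) (+-congˡ (sym (*-∑ x _))))) ⟩
    x * x ^ n + (1# - x) * (1# + x * ∑ {n} (λ k → x ^ toℕ k))
      ≈⟨ solve 3 (λ x y s → x :* y :+ (con (+ 1) :- x) :* (con (+ 1) :+ x :* s)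
           := (con (+ 1) :- x) :+ x :* (y :+ (con (+ 1) :- x) :* s)) refl x (x ^ n) _ ⟩
    (1# - x) + x * (x ^ n + (1# - x) * ∑ {n} (λ k → x ^ toℕ k))
      ≈⟨ +-congˡ (*-congˡ (geometric-sum n x)) ⟩
    (1# - x) + x * 1#
      ≈⟨ solve 1 (λ x → (con (+ 1) :- x) :+ x :* con (+ 1) := con (+ 1)) refl x ⟩
    1# ∎

  1-x∣1-x^ : ∀ n x → 1# - x ^ n ≈ (1# - x) * ∑ {n} (λ k → x ^ toℕ k)
  1-x∣1-x^ n x = trans (+-congʳ (sym (geometric-sum n x)))
    (solve 2 (λ a b → (a :+ b) :- a := b) refl (x ^ n) _)

  π : Carrier
  π = 1# - w

  w^p≈1 : w ^ p ≈ 1#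
  w^p≈1 = begin
    w ^ p              ≈⟨ +-identityʳ _ ⟨
    w ^ p + 0#         ≈⟨ +-congˡ (trans (*-congˡ geometric) (zeroʳ π)) ⟨
    w ^ p + π * ∑ {p} (λ k → w ^ toℕ k)  ≈⟨ geometric-sum p w ⟩
    1#                 ∎

  w^-periodic : ∀ m k → w ^ (m ℕ.+ k ℕ.* p) ≈ w ^ m
  w^-periodic m k = begin
    w ^ (m ℕ.+ k ℕ.* p)      ≈⟨ ^-homo-* w m (k ℕ.* p) ⟩
    w ^ m * w ^ (k ℕ.* p)    ≡⟨ ≡.cong (λ e → w ^ m * w ^ e) (ℕ.*-comm k p) ⟩
    w ^ m * w ^ (p ℕ.* k)    ≈⟨ *-congˡ (trans (sym (^-assocʳ w p k)) (trans (^-congˡ k w^p≈1) (1^ k))) ⟩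
    w ^ m * 1#               ≈⟨ *-identityʳ _ ⟩
    w ^ m                    ∎

  w^-∣ : ∀ {m} → p ℕ.∣ m → w ^ m ≈ 1#
  w^-∣ (ℕ.divides k ≡.refl) = w^-periodic 0 k

  opaque
    -- As the w^k sum to 0, p is the sum of the 1 - w^k, each of which π divides.
    π∣p : ∃ λ s → ι (+ p) ≈ π * s
    π∣p = _ , (begin
      ι (+ p)                                          ≈⟨ +-identityʳ _ ⟨
      ι (+ p) + 0#                                     ≈⟨ +-cong (∑-1 p) (trans (*-congˡ geometric) (zeroʳ _)) ⟨
      ∑ {p} (λ _ → 1#) + - 1# * ∑ {p} (λ k → w ^ toℕ k) ≈⟨ +-congˡ (*-∑ _ _) ⟩
      ∑ {p} (λ _ → 1#) + ∑ {p} (λ k → - 1# * w ^ toℕ k) ≈⟨ ∑-+ _ _ ⟨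
      ∑ {p} (λ k → 1# + - 1# * w ^ toℕ k)
        ≈⟨ ∑-cong (λ k → trans (solve 1 (λ x → con (+ 1) :+ :- con (+ 1) :* x := con (+ 1) :- x) refl _)
                               (1-x∣1-x^ (toℕ k) w)) ⟩
      ∑ {p} (λ k → π * ∑ {toℕ k} (λ j → w ^ toℕ j))    ≈⟨ *-∑ π _ ⟨
      π * ∑ {p} (λ k → ∑ {toℕ k} (λ j → w ^ toℕ j))    ∎)

  ∣p⇒regular : ∀ {x} → (∃ λ y → ι (+ p) ≈ x * y) → Regular x
  ∣p⇒regular (y , e) {z} h = torsion-free (trans (*-congʳ e)
    (trans (solve 3 (λ x y z → (x :* y) :* z := y :* (x :* z)) refl _ y z) (trans (*-congˡ h) (zeroʳ y))))

  π-regular : Regular π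
  π-regular = ∣p⇒regular π∣p

  ∑-w^m-∣ : ∀ {m} → p ℕ.∣ m → ∑ {p} (λ k → (w ^ m) ^ toℕ k) ≈ ι (+ p)
  ∑-w^m-∣ d = trans (∑-cong λ k → trans (^-congˡ (toℕ k) (w^-∣ d)) (1^ (toℕ k))) (∑-1 p)

  -- The sum is annihilated by 1 - w^m. For m' inverse to m modulo p, w = (w^m)^m', so π is a
  -- multiple of 1 - w^m and annihilates the sum too; but π is regular.
  ∑-w^m-∤ : ∀ {m} → Prime p → ¬ (p ℕ.∣ m) → ∑ {p} (λ k → (w ^ m) ^ toℕ k) ≈ 0#
  ∑-w^m-∤ {m} pr p∤m with modular-inverse pr p∤m
  ... | m′ , a , b , e = π-regular (begin
    π * S                            ≈⟨ *-congʳ (+-congˡ (-‿cong w≈)) ⟩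
    (1# - (w ^ m) ^ m′) * S          ≈⟨ *-congʳ (1-x∣1-x^ m′ (w ^ m)) ⟩
    ((1# - w ^ m) * T) * S           ≈⟨ solve 3 (λ a t s → (a :* t) :* s := t :* (a :* s)) refl _ T S ⟩
    T * ((1# - w ^ m) * S)           ≈⟨ *-congˡ (1-x∣1-x^ p (w ^ m)) ⟨
    T * (1# - (w ^ m) ^ p)           ≈⟨ *-congˡ (+-congˡ (-‿cong (trans (^-assocʳ w m p) (w^-∣ (ℕ.n∣m*n m))))) ⟩
    T * (1# - 1#)                    ≈⟨ trans (*-congˡ (-‿inverseʳ 1#)) (zeroʳ T) ⟩
    0#                               ∎)
    where
    S = ∑ {p} (λ k → (w ^ m) ^ toℕ k)
    T = ∑ {m′} (λ k → (w ^ m) ^ toℕ k)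
    w≈ : w ≈ (w ^ m) ^ m′
    w≈ = begin
      w                                ≈⟨ *-identityʳ w ⟨
      w ^ 1                            ≈⟨ w^-periodic 1 b ⟨
      w ^ (1 ℕ.+ b ℕ.* p)              ≡⟨ ≡.cong (w ^_) e ⟨
      w ^ (m ℕ.* m′ ℕ.+ a ℕ.* p)       ≈⟨ w^-periodic (m ℕ.* m′) a ⟩
      w ^ (m ℕ.* m′)                   ≈⟨ ^-assocʳ w m m′ ⟨
      (w ^ m) ^ m′                     ∎

  infix 4 _≈_mod_
  _≈_mod_ : Carrier → Carrier → Carrier → Set
  x ≈ y mod d = ∃ λ t → x ≈ y + d * t

  ≈⇒mod : ∀ {x y d} → x ≈ y → x ≈ y mod d
  ≈⇒mod {d = d} e = 0# , trans e (sym (trans (+-congˡ (zeroʳ d)) (+-identityʳ _)))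

  mod-trans : ∀ {x y z d} → x ≈ y mod d → y ≈ z mod d → x ≈ z mod d
  mod-trans (t , e) (t′ , e′) = t′ + t , trans e (trans (+-congʳ e′)
    (solve 4 (λ z d t t′ → (z :+ d :* t′) :+ d :* t := z :+ d :* (t′ :+ t)) refl _ _ t t′))

  mod-* : ∀ {x y x′ y′ d} → x ≈ y mod d → x′ ≈ y′ mod d → x * x′ ≈ y * y′ mod d
  mod-* {y = y} {y′ = y′} {d} (t , e) (t′ , e′) = t * y′ + t′ * (y + d * t) , trans (*-cong e e′)
    (solve 5 (λ y y′ d t t′ → (y :+ d :* t) :* (y′ :+ d :* t′)
      := (y :* y′) :+ d :* (t :* y′ :+ t′ :* (y :+ d :* t))) refl y y′ d t t′)

  mod-∑ : ∀ {n d} {f g : Fin n → Carrier} → (∀ i → f i ≈ g i mod d) → ∑ f ≈ ∑ g mod d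
  mod-∑ {d = d} h = _ , trans (∑-cong (proj₂ ∘ h)) (trans (∑-+ _ _) (+-congˡ (sym (*-∑ d _))))

  mod-^ : ∀ n {x y d} → x ≈ y mod d → x ^ n ≈ y ^ n mod d
  mod-^ zero    h = ≈⇒mod refl
  mod-^ (suc n) h = mod-* h (mod-^ n h)

  mod-π² : ∀ {x y} → x ≈ y mod (π * π) → x ≈ y mod π
  mod-π² (t , e) = π * t , trans e (+-congˡ (*-assoc π π t))

  opaque
    w^≈1-mπ : ∀ m → w ^ m ≈ 1# - ι (+ m) * π mod (π * π)
    w^≈1-mπ zero = 0# , (begin
      1#    ≈⟨ solve 1 (λ x → con (+ 1) := (con (+ 1) :- con (+ 0) :* x) :+ x :* x :* con (+ 0)) refl π ⟩
      (1# - 0# * π) + π * π * 0#    ≈⟨ +-congʳ (+-congˡ (-‿cong (*-congʳ ι-0))) ⟨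
      (1# - ι (+ 0) * π) + π * π * 0#  ∎)
    w^≈1-mπ (suc m) with w^≈1-mπ m
    -- Multiplying 1 - m π by w = 1 - π leaves the new second-order term m π².
    ... | t , e = ι (+ m) + w * t , (begin
      w * w ^ m                                       ≈⟨ *-congˡ e ⟩
      w * ((1# - ι (+ m) * π) + π * π * t)
        ≈⟨ solve 3 (λ w m t → let π = con (+ 1) :- w in
             w :* ((con (+ 1) :- m :* π) :+ π :* π :* t)
             := (con (+ 1) :- (con (+ 1) :+ m) :* π) :+ π :* π :* (m :+ w :* t)) refl w (ι (+ m)) t ⟩
      (1# - (1# + ι (+ m)) * π) + π * π * (ι (+ m) + w * t)
        ≈⟨ +-congʳ (+-congˡ (-‿cong (*-congʳ (ι-suc m)))) ⟨
      (1# - ι (+ suc m) * π) + π * π * (ι (+ m) + w * t)  ∎)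

  w^≈1 : ∀ m → w ^ m ≈ 1# mod π
  w^≈1 m = mod-trans (mod-π² (w^≈1-mπ m)) (- ι (+ m) ,
    solve 2 (λ m p → con (+ 1) :- m :* p := con (+ 1) :+ p :* (:- m)) refl _ π)

  -- The number N of terms may exceed n + 1, because the Pascal step needs the expansion of (1 -
  -- x)^n with N terms and with N + 1.
  binomial-expansion : ∀ n N x → n ℕ.< N →
    ∑ {N} (λ k → ι (binomial n (toℕ k)) * x ^ toℕ k) ≈ (1# - x) ^ n
  binomial-expansion zero (suc N) x _ = begin
    _    ≈⟨ ∑-suc _ ⟩
    ι (+ 1) * 1# + ∑ {N} (λ k → ι (+ 0) * x ^ suc (toℕ k))
      ≈⟨ +-cong (trans (*-identityʳ _) ι-1) (trans (∑-cong λ k → trans (*-congʳ ι-0) (zeroˡ _)) (∑-0 N)) ⟩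
    1# + 0#  ≈⟨ +-identityʳ 1# ⟩
    1#       ∎
  binomial-expansion (suc n) (suc N) x (s≤s n<N) = begin
    _    ≈⟨ ∑-suc _ ⟩
    ι (binomial n 0) * 1# + ∑ {N} (λ k → ι (binomial n (suc (toℕ k)) ℤ.- binomial n (toℕ k)) * x ^ suc (toℕ k))
      ≈⟨ +-congˡ (∑-cong λ k → trans (*-congʳ (trans (ι-+ _ _) (+-congˡ (ι-neg _))))
           (solve 4 (λ a b x y → (a :- b) :* (x :* y) := a :* (x :* y) :+ (:- x) :* (b :* y)) refl _ _ x _)) ⟩
    ι (binomial n 0) * 1# + ∑ {N} (λ k → F (suc (toℕ k)) + - x * F (toℕ k))
      ≈⟨ +-congˡ (trans (∑-+ _ _) (+-congˡ (sym (*-∑ (- x) _)))) ⟩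
    F 0 + (∑ {N} (λ k → F (suc (toℕ k))) + - x * ∑ {N} (λ k → F (toℕ k)))
      ≈⟨ +-assoc _ _ _ ⟨
    (F 0 + ∑ {N} (λ k → F (suc (toℕ k)))) + - x * ∑ {N} (λ k → F (toℕ k))
      ≈⟨ +-congʳ (∑-suc _) ⟨
    ∑ {suc N} (λ k → F (toℕ k)) + - x * ∑ {N} (λ k → F (toℕ k))
      ≈⟨ +-cong (binomial-expansion n (suc N) x (ℕ.m<n⇒m<1+n n<N)) (*-congˡ (binomial-expansion n N x n<N)) ⟩
    (1# - x) ^ n + - x * (1# - x) ^ n
      ≈⟨ solve 2 (λ x y → y :+ (:- x) :* y := (con (+ 1) :- x) :* y) refl x _ ⟩
    (1# - x) ^ suc n ∎
    where
    F : ℕ → Carrier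
    F k = ι (binomial n k) * x ^ k

-- Divisibility by π

module CyclotomicPrime {q : ℕ} (pr : Prime (suc q)) (1<q : 1 ℕ.< q) (K : CyclotomicIntegers (suc q)) where
  open Cyclotomic K public
  open import Relation.Binary.Reasoning.Setoid setoid

  p : ℕ
  p = suc q

  -- (1 - x)^q ≡ 1 + x + ⋯ + x^q modulo p; at x = w the right-hand side vanishes,
  -- at x = 1 it is p.
  private
    C : Fin p → Carrier
    C k = ι (proj₁ (binomial-mod-prime pr (toℕ k) (ℕ.≤-pred (Fin.toℕ<n k))))

    expansion : ∀ x → (1# - x) ^ q ≈ ∑ {p} (λ k → x ^ toℕ k) + ι (+ p) * ∑ (λ k → C k * x ^ toℕ k)
    expansion x = begin
      (1# - x) ^ q                                      ≈⟨ binomial-expansion q p x (ℕ.n<1+n q) ⟨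
      ∑ {p} (λ k → ι (binomial q (toℕ k)) * x ^ toℕ k)  ≈⟨ ∑-cong term ⟩
      ∑ (λ k → x ^ toℕ k + ι (+ p) * (C k * x ^ toℕ k)) ≈⟨ ∑-+ _ _ ⟩
      _ + ∑ (λ k → ι (+ p) * (C k * x ^ toℕ k))         ≈⟨ +-congˡ (*-∑ _ _) ⟨
      _                                                 ∎
      where
      term : ∀ k → ι (binomial q (toℕ k)) * x ^ toℕ k ≈ x ^ toℕ k + ι (+ p) * (C k * x ^ toℕ k)
      term k with binomial-mod-prime pr (toℕ k) (ℕ.≤-pred (Fin.toℕ<n k))
      ... | c , e = begin
        ι (binomial q (toℕ k)) * x ^ toℕ k         ≡⟨ ≡.cong (λ b → ι b * x ^ toℕ k) e ⟩
        ι (+ 1 ℤ.+ + p ℤ.* c) * x ^ toℕ k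
          ≈⟨ *-congʳ (trans (ι-+ _ _) (+-cong ι-1 (ι-* _ _))) ⟩
        (1# + ι (+ p) * ι c) * x ^ toℕ k
          ≈⟨ solve 3 (λ p c y → (con (+ 1) :+ p :* c) :* y := y :+ p :* (c :* y)) refl _ _ _ ⟩
        x ^ toℕ k + ι (+ p) * (ι c * x ^ toℕ k)    ∎

  u : Carrier
  u = ∑ (λ k → C k * w ^ toℕ k)

  π^q≈pu : π ^ q ≈ ι (+ p) * u
  π^q≈pu = trans (expansion w) (trans (+-congʳ geometric) (+-identityˡ _))

  opaque
    -- Since w ≡ 1, u is congruent to its analogue U at x = 1. There the expansion reads 0 = p + p
    -- U, so U = -1 by torsion-freeness.
    u≈-1 : u ≈ - 1# mod π
    u≈-1 = mod-trans (mod-∑ λ k → mod-* (≈⇒mod {C k} refl) (mod-trans (w^≈1 (toℕ k)) (≈⇒mod (sym (1^ (toℕ k))))))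
      (≈⇒mod (begin
        U                    ≈⟨ solve 1 (λ x → x := :- con (+ 1) :+ (con (+ 1) :+ x)) refl U ⟩
        - 1# + (1# + U)      ≈⟨ +-congˡ (torsion-free 1+U) ⟩
        - 1# + 0#            ≈⟨ +-identityʳ _ ⟩
        - 1#                 ∎))
      where
      U : Carrier
      U = ∑ (λ k → C k * 1# ^ toℕ k)
      1+U : ι (+ p) * (1# + U) ≈ 0#
      1+U = begin
        ι (+ p) * (1# + U)                            ≈⟨ solve 2 (λ p u → p :* (con (+ 1) :+ u) := p :+ p :* u) refl _ U ⟩
        ι (+ p) + ι (+ p) * U                         ≈⟨ +-congʳ (trans (∑-cong λ k → 1^ (toℕ k)) (∑-1 p)) ⟨
        ∑ {p} (λ k → 1# ^ toℕ k) + ι (+ p) * U        ≈⟨ expansion 1# ⟨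
        (1# - 1#) ^ q                                 ≈⟨ ^-congˡ q (-‿inverseʳ 1#) ⟩
        0# ^ q                                        ≈⟨ 0^ 1<q ⟩
        0#                                            ∎
        where
        0^ : ∀ {n} → 1 ℕ.< n → 0# ^ n ≈ 0#
        0^ {suc n} _ = zeroˡ _

  opaque
    -- Write u = -1 + π t, so that p = p π t - p u. Here π² divides p π t because π ∣ p, and it
    -- divides p u = π^q because q ≥ 2, that is, p ≥ 3.
    π²∣p : ∃ λ y → ι (+ p) ≈ (π * π) * y
    π²∣p = step 1<q π^q≈pu
      where
      step : ∀ {n} → 1 ℕ.< n → π ^ n ≈ ι (+ p) * u → ∃ λ y → ι (+ p) ≈ (π * π) * y
      step {suc (suc n)} _ e with u≈-1 | π∣p
      ... | t , e₁ | s , e₂ = s * t - π ^ n , (begin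
        ι (+ p)
          ≈⟨ solve 3 (λ p x t → p := p :* (x :* t) :- p :* (:- con (+ 1) :+ x :* t)) refl (ι (+ p)) π t ⟩
        ι (+ p) * (π * t) - ι (+ p) * (- 1# + π * t)
          ≈⟨ +-cong (*-congʳ e₂) (-‿cong (trans (*-congˡ (sym e₁)) (sym e))) ⟩
        (π * s) * (π * t) - π * (π * π ^ n)
          ≈⟨ solve 4 (λ x s t y → (x :* s) :* (x :* t) :- x :* (x :* y) := (x :* x) :* (s :* t :- y)) refl π s t _ ⟩
        (π * π) * (s * t - π ^ n) ∎)
      step {suc zero} (s≤s ()) e

  -- Raised to the power q, the equation makes m^q a multiple of π^q = p u. This descends to ℤ,
  -- where p is prime.
  π∣⇒p∣ : ∀ {m x} → ι m ≈ π * x → + p ℤ.∣ m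
  π∣⇒p∣ {m} {x} e = prime-∣-^ pr m q (ι-∣ (begin
    ι (m ℤ.^ q)             ≈⟨ ι-^ m q ⟩
    ι m ^ q                 ≈⟨ trans (^-congˡ q e) (*-^ q π x) ⟩
    π ^ q * x ^ q           ≈⟨ trans (*-congʳ π^q≈pu) (*-assoc _ _ _) ⟩
    ι (+ p) * (u * x ^ q)   ∎))

  opaque
    ι-p∣ : ∀ {m} → + p ℤ.∣ m → ∃ λ y → ι m ≈ (π * π) * y
    ι-p∣ {m} d with ℤˢ.∣ᵤ⇒∣ {+ p} {m} d | π²∣p
    ... | ℤˢ.divides k ≡.refl | y , e = y * ι k , trans (ι-* _ _) (trans (*-congˡ e)
      (solve 3 (λ k d y → k :* (d :* y) := d :* (y :* k)) refl (ι k) (π * π) y))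

  -- Invertibility in the residue field R/π = 𝔽_p, not in R.
  record Unit (v : Carrier) : Set where
    constructor unit
    field
      residue : ℤ
      ≈-mod-π : v ≈ ι residue mod π
      p∤      : ¬ (+ p ℤ.∣ residue)

  unit-≈ : ∀ {x y} → x ≈ y → Unit x → Unit y
  unit-≈ e (unit n h p∤n) = unit n (mod-trans (≈⇒mod (sym e)) h) p∤n

  unit-1 : Unit 1#
  unit-1 = unit (+ 1) (≈⇒mod (sym ι-1)) (prime∤1 pr)

  unit-* : ∀ {x y} → Unit x → Unit y → Unit (x * y)
  unit-* (unit m h p∤m) (unit n k p∤n) = unit (m ℤ.* n)
    (mod-trans (mod-* h k) (≈⇒mod (sym (ι-* m n))))
    (λ d → case (prime-∣-* pr m n d))
    where
    case : ¬ ((+ p ℤ.∣ m) ⊎ (+ p ℤ.∣ n))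
    case (inj₁ d) = p∤m d
    case (inj₂ d) = p∤n d

  unit-^ : ∀ {x} n → Unit x → Unit (x ^ n)
  unit-^ zero    h = unit-1
  unit-^ (suc n) h = unit-* h (unit-^ n h)

  unit-u : Unit u
  unit-u = unit -[1+ 0 ] (mod-trans u≈-1 (≈⇒mod (trans (-‿cong (sym ι-1)) (sym (ι-neg (+ 1)))))) (prime∤1 pr)

  ¬unit-multiple : ∀ {x} → ¬ Unit (π * x)
  ¬unit-multiple {x} (unit n (t , e) p∤n) = p∤n (π∣⇒p∣ {x = x - t} (begin
    ι n                   ≈⟨ solve 2 (λ n y → n := (n :+ y) :- y) refl (ι n) (π * t) ⟩
    (ι n + π * t) - π * t ≈⟨ +-congʳ e ⟨
    π * x - π * t         ≈⟨ solve 3 (λ a x t → a :* x :- a :* t := a :* (x :- t)) refl π x t ⟩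
    π * (x - t)           ∎))

  -- For Good = ⊤ this is divisibility of x by d; for Good = Unit the cofactor is moreover prime to π.
  module Valuation (Good : Carrier → Set) (good-1 : Good 1#)
                   (good-* : ∀ {x y} → Good x → Good y → Good (x * y)) where

    _∥_ : Carrier → Carrier → Set
    d ∥ x = ∃ λ v → x ≈ d * v × Good v

    ∥-≈ : ∀ {d e x y} → d ≈ e → x ≈ y → d ∥ x → e ∥ y
    ∥-≈ h k (v , e , g) = v , trans (sym k) (trans e (*-congʳ h)) , g

    ∥-* : ∀ {d e x y} → d ∥ x → e ∥ y → (d * e) ∥ (x * y)
    ∥-* (v , e , g) (v′ , e′ , g′) = v * v′ , trans (*-cong e e′)
      (solve 4 (λ d v e v′ → (d :* v) :* (e :* v′) := (d :* e) :* (v :* v′)) refl _ v _ v′) , good-* g g′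

    ∥-∏ : ∀ {n} {d : Carrier} {f : Fin n → Carrier} → (∀ i → d ∥ f i) → (d ^ n) ∥ ∏ f
    ∥-∏ {zero}  h = 1# , trans (∏-zero _) (sym (*-identityˡ 1#)) , good-1
    ∥-∏ {suc n} h = ∥-≈ refl (sym (∏-suc _)) (∥-* (h zero) (∥-∏ (h ∘ suc)))

    ∥-∏-except : ∀ {n} {d e : Carrier} {f : Fin (suc n) → Carrier} i →
                 e ∥ f i → (∀ j → j ≢ i → d ∥ f j) → (e * d ^ n) ∥ ∏ f
    ∥-∏-except i h k = ∥-≈ refl (sym (∏-punchIn i _)) (∥-* h (∥-∏ λ j → k _ (Fin.punchInᵢ≢i i j)))

    -- Row 0 contributes c π^q and each of the other q rows π^(q+2), in all c π^(q(q+3)) = c (p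
    -- u)^(q+3). The family f is arbitrary so that the grid of eigenvalues can be read by rows or by
    -- columns.
    ∥-∏∏ : ∀ {c} (f : Fin p → Fin p → Carrier) → c ∥ f zero zero → (∀ j → π ∥ f zero (suc j)) →
           (∀ i → ∃ λ j → ((π * π) ∥ f (suc i) j) × (∀ j′ → j′ ≢ j → π ∥ f (suc i) j′)) →
           (c * (ι (+ (p ℕ.^ (3 ℕ.+ q))) * u ^ (3 ℕ.+ q))) ∥ ∏ (λ i → ∏ (f i))
    ∥-∏∏ {c} f h₀ h₁ h₂ = ∥-≈ total (sym (∏-suc _)) (∥-*
      (∥-∏-except zero h₀ λ { zero 0≢0 → contradiction ≡.refl 0≢0 ; (suc j) _ → h₁ j })
      (∥-∏ λ i → ∥-∏-except (proj₁ (h₂ i)) (proj₁ (proj₂ (h₂ i))) (proj₂ (proj₂ (h₂ i)))))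
      where
      total : (c * π ^ q) * ((π * π) * π ^ q) ^ q ≈ c * (ι (+ (p ℕ.^ (3 ℕ.+ q))) * u ^ (3 ℕ.+ q))
      total = begin
        (c * π ^ q) * ((π * π) * π ^ q) ^ q
          ≈⟨ *-congˡ (trans (*-^ q _ _) (*-congʳ (*-^ q π π))) ⟩
        (c * π ^ q) * ((π ^ q * π ^ q) * (π ^ q) ^ q)
          ≈⟨ solve 3 (λ c x y → (c :* x) :* ((x :* x) :* y) := c :* (x :* (x :* (x :* y)))) refl c (π ^ q) _ ⟩
        c * (π ^ q) ^ (3 ℕ.+ q)
          ≈⟨ *-congˡ (^-congˡ (3 ℕ.+ q) π^q≈pu) ⟩
        c * (ι (+ p) * u) ^ (3 ℕ.+ q)
          ≈⟨ *-congˡ (trans (*-^ (3 ℕ.+ q) _ u) (*-congʳ (sym (ι-ℕ^ p (3 ℕ.+ q))))) ⟩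
        c * (ι (+ (p ℕ.^ (3 ℕ.+ q))) * u ^ (3 ℕ.+ q)) ∎

-- Subtraction in ℤ_p

module _ {p : ℕ} .{{_ : NonZero p}} where
  open import Data.Nat using (_+_; _*_; _∸_; _%_; _/_)
  open ≡.≡-Reasoning

  toℕ-subₚ : ∀ a b → toℕ (Defs.subₚ p a b) + (toℕ a + (p ∸ toℕ b)) / p * p ≡ toℕ a + (p ∸ toℕ b)
  toℕ-subₚ a b = ≡.trans (≡.cong (_+ x / p * p) (Fin.toℕ-fromℕ< (ℕ.m%n<n x p))) (≡.sym (ℕ.m≡m%n+[m/n]*n x p))
    where x = toℕ a + (p ∸ toℕ b)

  [p∸i]+i : ∀ (i : Fin p) → p ∸ toℕ i + toℕ i ≡ p
  [p∸i]+i i = ℕ.m∸n+n≡m (ℕ.<⇒≤ (Fin.toℕ<n i))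

  toℕ-injective-% : ∀ {i j : Fin p} a b → toℕ i + a * p ≡ toℕ j + b * p → i ≡ j
  toℕ-injective-% {i} {j} a b e = Fin.toℕ-injective (begin
    toℕ i                  ≡⟨ reduced i a ⟨
    (toℕ i + a * p) % p    ≡⟨ ≡.cong (_% p) e ⟩
    (toℕ j + b * p) % p    ≡⟨ reduced j b ⟩
    toℕ j                  ∎)
    where
    reduced : ∀ i a → (toℕ i + a * p) % p ≡ toℕ i
    reduced i a = ≡.trans (ℕ.[m+kn]%n≡m%n (toℕ i) a p) (ℕ.m<n⇒m%n≡m (Fin.toℕ<n i))

  -- Allows sums over h to be reindexed by g - h.
  subₚ-involutive : ∀ g h → Defs.subₚ p g (Defs.subₚ p g h) ≡ h
  subₚ-involutive g h = toℕ-injective-% k′ k (ℕ.+-cancelˡ-≡ x _ _ (begin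
    x + (toℕ y + k′ * p)         ≡⟨ ≡.cong (λ z → x + z) (toℕ-subₚ g s) ⟩
    x + (toℕ g + (p ∸ x))        ≡⟨ swap x (toℕ g) (p ∸ x) ⟩
    (p ∸ x + x) + toℕ g          ≡⟨ ≡.cong (_+ toℕ g) (≡.trans ([p∸i]+i s) (≡.sym ([p∸i]+i h))) ⟩
    p ∸ toℕ h + toℕ h + toℕ g    ≡⟨ swap′ (p ∸ toℕ h) (toℕ h) (toℕ g) ⟩
    toℕ g + (p ∸ toℕ h) + toℕ h  ≡⟨ ≡.cong (_+ toℕ h) (toℕ-subₚ g h) ⟨
    x + k * p + toℕ h            ≡⟨ swap″ x (k * p) (toℕ h) ⟩
    x + (toℕ h + k * p)          ∎))
    where
    s = Defs.subₚ p g h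
    y = Defs.subₚ p g s
    x = toℕ s
    k = (toℕ g + (p ∸ toℕ h)) / p
    k′ = (toℕ g + (p ∸ x)) / p
    swap : ∀ x g y → x + (g + y) ≡ (y + x) + g
    swap = ℕSolver.solve-∀
    swap′ : ∀ a h g → a + h + g ≡ g + a + h
    swap′ = ℕSolver.solve-∀
    swap″ : ∀ a k h → a + k + h ≡ a + (h + k)
    swap″ = ℕSolver.solve-∀

  -- The congruence -h c ≡ (-g + (g - h)) c modulo p, with p ∸ h for -h and the multiples of p
  -- written out, ready for `w^-periodic`.
  subₚ-exponents : ∀ g h c → (p ∸ toℕ h) * c + c * p ≡
    (p ∸ toℕ g + toℕ (Defs.subₚ p g h)) * c + (toℕ g + (p ∸ toℕ h)) / p * c * p
  subₚ-exponents g h c = begin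
    h′ * c + c * p                   ≡⟨ ≡.cong (λ z → h′ * c + c * z) ([p∸i]+i g) ⟨
    h′ * c + c * (g′ + toℕ g)        ≡⟨ collect h′ c g′ (toℕ g) ⟩
    (g′ + (toℕ g + h′)) * c          ≡⟨ ≡.cong (λ z → (g′ + z) * c) (toℕ-subₚ g h) ⟨
    (g′ + (x + m * p)) * c           ≡⟨ collect′ g′ x m p c ⟩
    (g′ + x) * c + m * c * p         ∎
    where
    h′ = p ∸ toℕ h
    g′ = p ∸ toℕ g
    x  = toℕ (Defs.subₚ p g h)
    m  = (toℕ g + (p ∸ toℕ h)) / p
    collect : ∀ h c g i → h * c + c * (g + i) ≡ (g + (i + h)) * c
    collect = ℕSolver.solve-∀
    collect′ : ∀ g x m p c → (g + (x + m * p)) * c ≡ (g + x) * c + m * c * p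
    collect′ = ℕSolver.solve-∀

  divides⇒≡ : ∀ {i j : Fin p} k → p ∸ toℕ i + toℕ j ≡ k * p → i ≡ j
  divides⇒≡ {i} {j} k e = toℕ-injective-% k 1 (begin
    toℕ i + k * p                     ≡⟨ ≡.cong (λ z → toℕ i + z) e ⟨
    toℕ i + (p ∸ toℕ i + toℕ j)       ≡⟨ swap (toℕ i) (p ∸ toℕ i) (toℕ j) ⟩
    toℕ j + 1 * (p ∸ toℕ i + toℕ i)   ≡⟨ ≡.cong (λ z → toℕ j + 1 * z) ([p∸i]+i i) ⟩
    toℕ j + 1 * p                     ∎)
    where
    swap : ∀ g a h → g + (a + h) ≡ h + 1 * (a + g)
    swap = ℕSolver.solve-∀

-- Diagonalisation of the group matrix by characters

module GroupDeterminant {p : ℕ} .{{_ : NonZero p}} (pr : Prime p) (K : CyclotomicIntegers p) where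
  open Cyclotomic K
  open Determinant commutativeRing
  open DeterminantProduct commutativeRing
  open import Relation.Binary.Reasoning.Setoid setoid

  ι-sign : ∀ k → ι (Defs.sign k) ≈ sgn k
  ι-sign zero          = ι-1
  ι-sign (suc zero)    = trans (ι-neg (+ 1)) (-‿cong ι-1)
  ι-sign (suc (suc k)) = trans (ι-sign k) (solve 1 (λ x → x := :- (:- x)) refl (sgn k))

  ι-det : ∀ n (A : Fin n → Fin n → ℤ) → ι (Defs.det n A) ≈ det n (λ i j → ι (A i j))
  ι-det zero    A = ι-1
  ι-det (suc n) A = trans (ι-∑ _) (∑-cong λ j →
    trans (ι-* _ _) (*-cong (ι-sign (toℕ j)) (trans (ι-* _ _) (*-congˡ {ι (A zero j)} (ι-det n _)))))

  χ χ⁻¹ : Fin p → Fin p → Carrier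
  χ   h k = w ^ (toℕ h ℕ.* toℕ k)
  χ⁻¹ h k = w ^ ((p ℕ.∸ toℕ h) ℕ.* toℕ k)

  eigenvalue : (Fin p → Fin p → ℤ) → Fin p → Fin p → Carrier
  eigenvalue a i j = ∑ (λ h₁ → ∑ (λ h₂ → ι (a h₁ h₂) * (χ h₁ i * χ h₂ j)))

  χ⁻¹-subₚ : ∀ g h k → χ⁻¹ h k ≈ χ⁻¹ g k * χ (Defs.subₚ p g h) k
  χ⁻¹-subₚ g h k = begin
    w ^ (h′ ℕ.* c)                          ≈⟨ w^-periodic (h′ ℕ.* c) c ⟨
    w ^ (h′ ℕ.* c ℕ.+ c ℕ.* p)              ≡⟨ ≡.cong (w ^_) (subₚ-exponents g h c) ⟩
    w ^ ((g′ ℕ.+ x) ℕ.* c ℕ.+ m ℕ.* c ℕ.* p) ≈⟨ w^-periodic ((g′ ℕ.+ x) ℕ.* c) (m ℕ.* c) ⟩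
    w ^ ((g′ ℕ.+ x) ℕ.* c)                  ≡⟨ ≡.cong (w ^_) (ℕ.*-distribʳ-+ c g′ x) ⟩
    w ^ (g′ ℕ.* c ℕ.+ x ℕ.* c)              ≈⟨ ^-homo-* w (g′ ℕ.* c) (x ℕ.* c) ⟩
    χ⁻¹ g k * χ (Defs.subₚ p g h) k         ∎
    where
    c  = toℕ k
    h′ = p ℕ.∸ toℕ h
    g′ = p ℕ.∸ toℕ g
    x  = toℕ (Defs.subₚ p g h)
    m  = (toℕ g ℕ.+ (p ℕ.∸ toℕ h)) ℕ./ p

  orthogonality : Fin p → Fin p → Carrier
  orthogonality g h = ∑ (λ k → χ⁻¹ g k * χ h k)

  private
    orthogonality-power : ∀ g h → orthogonality g h ≈ ∑ {p} (λ k → (w ^ (p ℕ.∸ toℕ g ℕ.+ toℕ h)) ^ toℕ k)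
    orthogonality-power g h = ∑-cong λ k → begin
      χ⁻¹ g k * χ h k
        ≈⟨ ^-homo-* w ((p ℕ.∸ toℕ g) ℕ.* toℕ k) (toℕ h ℕ.* toℕ k) ⟨
      w ^ ((p ℕ.∸ toℕ g) ℕ.* toℕ k ℕ.+ toℕ h ℕ.* toℕ k)
        ≡⟨ ≡.cong (w ^_) (ℕ.*-distribʳ-+ (toℕ k) (p ℕ.∸ toℕ g) (toℕ h)) ⟨
      w ^ ((p ℕ.∸ toℕ g ℕ.+ toℕ h) ℕ.* toℕ k)
        ≈⟨ ^-assocʳ w (p ℕ.∸ toℕ g ℕ.+ toℕ h) (toℕ k) ⟨
      (w ^ (p ℕ.∸ toℕ g ℕ.+ toℕ h)) ^ toℕ k ∎

  orthogonality-≡ : ∀ g → orthogonality g g ≈ ι (+ p)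
  orthogonality-≡ g = trans (orthogonality-power g g)
    (∑-w^m-∣ (≡.subst (p ℕ.∣_) (≡.sym ([p∸i]+i g)) ℕ.∣-refl))

  orthogonality-≢ : ∀ {g h} → g ≢ h → orthogonality g h ≈ 0#
  orthogonality-≢ {g} {h} g≢h = trans (orthogonality-power g h) (∑-w^m-∤ pr λ { (ℕ.divides k e) →
    g≢h (divides⇒≡ k e) })

  private
    _₁ _₂ : Fin (p ℕ.* p) → Fin p
    h ₁ = Fin.quotient {p} p h
    h ₂ = Fin.remainder {p} p h

    -- The columns of W are the inverse characters, common eigenvectors of all group matrices; V is
    -- its inverse up to the factor p².
    W V : Matrix (p ℕ.* p) (p ℕ.* p)
    W h k = χ⁻¹ (h ₁) (k ₁) * χ⁻¹ (h ₂) (k ₂)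
    V k h = χ (h ₁) (k ₁) * χ (h ₂) (k ₂)

    ⊙-diag : ∀ {n} (A : Matrix n n) d i j → (A ⊙ diag d) i j ≈ A i j * d j
    ⊙-diag A d i j = trans (∑-single j λ t t≢j → trans (*-congˡ (diag-≢ d t≢j)) (zeroʳ _)) (*-congˡ (diag-≡ d j))

    W⊙V : ∀ g h → (W ⊙ V) g h ≈ diag (λ _ → ι (+ p) * ι (+ p)) g h
    W⊙V g h = begin
      (W ⊙ V) g h
        ≈⟨ ∑-remQuot {p} {p} (λ k₁ k₂ → (χ⁻¹ (g ₁) k₁ * χ⁻¹ (g ₂) k₂) * (χ (h ₁) k₁ * χ (h ₂) k₂)) ⟩
      ∑ (λ k₁ → ∑ (λ k₂ → (χ⁻¹ (g ₁) k₁ * χ⁻¹ (g ₂) k₂) * (χ (h ₁) k₁ * χ (h ₂) k₂)))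
        ≈⟨ ∑-cong (λ k₁ → trans (∑-cong λ k₂ → solve 4 (λ a b c d → (a :* b) :* (c :* d) := (a :* c) :* (b :* d))
             refl _ _ _ _) (sym (*-∑ _ _))) ⟩
      ∑ (λ k₁ → (χ⁻¹ (g ₁) k₁ * χ (h ₁) k₁) * orthogonality (g ₂) (h ₂))
        ≈⟨ ∑-* _ _ ⟨
      orthogonality (g ₁) (h ₁) * orthogonality (g ₂) (h ₂)
        ≈⟨ scalar ⟩
      diag (λ _ → ι (+ p) * ι (+ p)) g h ∎
      where
      scalar : orthogonality (g ₁) (h ₁) * orthogonality (g ₂) (h ₂) ≈ diag (λ _ → ι (+ p) * ι (+ p)) g h
      scalar with g Fin.≟ h
      ... | yes ≡.refl = *-cong (orthogonality-≡ (g ₁)) (orthogonality-≡ (g ₂))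
      ... | no g≢h with g ₁ Fin.≟ h ₁
      ...   | no  ne = trans (*-congʳ (orthogonality-≢ ne)) (zeroˡ _)
      ...   | yes e₁ = trans (*-congˡ (orthogonality-≢ λ e₂ → g≢h (≡.trans (≡.sym (Fin.combine-remQuot {p} p g))
                 (≡.trans (≡.cong₂ Fin.combine e₁ e₂) (Fin.combine-remQuot {p} p h))))) (zeroʳ _)

  module _ (a : Fin p → Fin p → ℤ) where
    private
      A : Matrix (p ℕ.* p) (p ℕ.* p)
      A g h = ι (a (Defs.subₚ p (g ₁) (h ₁)) (Defs.subₚ p (g ₂) (h ₂)))

      d : Fin (p ℕ.* p) → Carrier
      d k = eigenvalue a (k ₁) (k ₂)

      A⊙W : ∀ g k → (A ⊙ W) g k ≈ (W ⊙ diag d) g k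
      A⊙W g k = begin
        (A ⊙ W) g k
          ≈⟨ ∑-remQuot {p} {p} (λ h₁ h₂ → ι (a (s₁ h₁) (s₂ h₂)) * (χ⁻¹ h₁ (k ₁) * χ⁻¹ h₂ (k ₂))) ⟩
        ∑ (λ h₁ → ∑ (λ h₂ → ι (a (s₁ h₁) (s₂ h₂)) * (χ⁻¹ h₁ (k ₁) * χ⁻¹ h₂ (k ₂))))
          ≈⟨ ∑-cong (λ h₁ → trans (∑-cong λ h₂ → term h₁ h₂) (sym (*-∑ _ _))) ⟩
        ∑ (λ h₁ → W g k * ∑ (λ h₂ → G (s₁ h₁) (s₂ h₂)))
          ≈⟨ *-∑ _ _ ⟨
        W g k * ∑ (λ h₁ → ∑ (λ h₂ → G (s₁ h₁) (s₂ h₂)))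
          ≈⟨ *-congˡ (∑-cong λ h₁ → ∑-involution s₂ (subₚ-involutive (g ₂)) (G (s₁ h₁))) ⟩
        W g k * ∑ (λ h₁ → ∑ (G (s₁ h₁)))
          ≈⟨ *-congˡ (∑-involution s₁ (subₚ-involutive (g ₁)) (λ h₁ → ∑ (G h₁))) ⟩
        W g k * d k
          ≈⟨ ⊙-diag W d g k ⟨
        (W ⊙ diag d) g k ∎
        where
        s₁ = Defs.subₚ p (g ₁)
        s₂ = Defs.subₚ p (g ₂)
        G : Fin p → Fin p → Carrier
        G h₁ h₂ = ι (a h₁ h₂) * (χ h₁ (k ₁) * χ h₂ (k ₂))
        term : ∀ h₁ h₂ → ι (a (s₁ h₁) (s₂ h₂)) * (χ⁻¹ h₁ (k ₁) * χ⁻¹ h₂ (k ₂)) ≈ W g k * G (s₁ h₁) (s₂ h₂)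
        term h₁ h₂ = trans (*-congˡ (*-cong (χ⁻¹-subₚ (g ₁) h₁ (k ₁)) (χ⁻¹-subₚ (g ₂) h₂ (k ₂))))
          (solve 5 (λ a x y z t → a :* ((x :* y) :* (z :* t)) := (x :* z) :* (a :* (y :* t))) refl _ _ _ _ _)

    -- A W = W D and W V = p² I, so det A · det (W V) = det D · det (W V), where det (W V) is regular.
    groupDet≈∏eigenvalue : ι (Defs.groupDet p a) ≈ ∏ (λ i → ∏ (eigenvalue a i))
    groupDet≈∏eigenvalue = trans (ι-det (p ℕ.* p) _) (trans (regular-cancel regular (begin
      P * det n A               ≈⟨ *-comm _ _ ⟩
      det n A * P               ≈⟨ *-congˡ P≈ ⟨
      det n A * (det n W * det n V)   ≈⟨ *-assoc _ _ _ ⟨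
      (det n A * det n W) * det n V   ≈⟨ *-congʳ (trans (sym (det-⊙ A W))
                                           (trans (det-cong n A⊙W) (det-⊙ W (diag d)))) ⟩
      (det n W * det n (diag d)) * det n V
        ≈⟨ solve 3 (λ w d v → (w :* d) :* v := (w :* v) :* d) refl _ _ _ ⟩
      (det n W * det n V) * det n (diag d)  ≈⟨ *-cong P≈ (det-diag d) ⟩
      P * ∏ d                   ∎)) (∏-remQuot {p} {p} (eigenvalue a)))
      where
      n = p ℕ.* p
      P = ∏ {n} (λ _ → ι (+ p) * ι (+ p))
      P≈ : det n W * det n V ≈ P
      P≈ = trans (sym (det-⊙ W V)) (trans (det-cong n W⊙V) (det-diag (λ _ → ι (+ p) * ι (+ p))))
      regular : Regular P
      regular = regular-∏ {n} λ _ → regular-* torsion-free torsion-free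

-- Polynomials with prescribed reduced coefficients

-- The local functions of the definition of reduce are private; unification recovers them.
mutual
  polyRed : (p : ℕ) .{{_ : NonZero p}} → ℕ → Defs.Poly → Fin p → Fin p → ℤ
  polyRed = _

  rowRed : (p : ℕ) .{{_ : NonZero p}} → ℕ → List ℤ → Fin p → ℤ
  rowRed = _

  reduce≡polyRed : ∀ p .{{_ : NonZero p}} F a b → Defs.reduce p F a b ≡ polyRed p 0 F a b
  reduce≡polyRed p F a b with ℕ.zero
  -- With a variable i in place of the index 0, the equation determines `polyRed` at every starting
  -- index.
  ... | i = ≡.refl

  reduce-row≡rowRed : ∀ p .{{_ : NonZero p}} r a b →
    Defs.reduce p (r List.∷ List.[]) a b ≡ (if does (0 ℕ.mod p Fin.≟ a) then rowRed p 0 r b else + 0) ℤ.+ + 0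
  reduce-row≡rowRed p r a b with ℕ.zero
  ... | i = ≡.refl

∑ℤ-cong : ∀ {n} {f g : Fin n → ℤ} → (∀ i → f i ≡ g i) → Defs.∑ f ≡ Defs.∑ g
∑ℤ-cong {zero}  h = ≡.refl
∑ℤ-cong {suc n} h = ≡.cong₂ ℤ._+_ (h zero) (∑ℤ-cong (h ∘ suc))

∑ℤ-0 : ∀ n → Defs.∑ {n} (λ _ → + 0) ≡ + 0
∑ℤ-0 zero    = ≡.refl
∑ℤ-0 (suc n) = ≡.trans (ℤ.+-identityˡ _) (∑ℤ-0 n)

∑ℤ-select : ∀ {n} (f : Fin n → ℤ) b → Defs.∑ (λ i → if does (i Fin.≟ b) then f i else + 0) ≡ f b
∑ℤ-select {suc n} f zero    = ≡.trans (≡.cong (λ z → f zero ℤ.+ z) (∑ℤ-0 n)) (ℤ.+-identityʳ _)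
∑ℤ-select {suc n} f (suc b) = ≡.trans (ℤ.+-identityˡ _) (∑ℤ-select (f ∘ suc) b)

module _ {p : ℕ} .{{_ : NonZero p}} where
  open ≡.≡-Reasoning

  toℕ-mod : ∀ (i : Fin p) → toℕ i ℕ.mod p ≡ i
  toℕ-mod i = Fin.toℕ-injective (≡.trans (Fin.toℕ-fromℕ< (ℕ.m%n<n (toℕ i) p)) (ℕ.m<n⇒m%n≡m (Fin.toℕ<n i)))

  private
    at : ℕ → Fin p → ℤ → ℤ
    at j b z = if does (j ℕ.mod p Fin.≟ b) then z else + 0

    ∑ℤ-at : ∀ (f : Fin p → ℤ) b → Defs.∑ (λ i → at (toℕ i) b (f i)) ≡ f b
    ∑ℤ-at f b = ≡.trans (∑ℤ-cong λ i → ≡.cong (λ k → if does (k Fin.≟ b) then f i else + 0) (toℕ-mod i))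
                        (∑ℤ-select f b)

  rowRed-tabulate : ∀ {n} j (f : Fin n → ℤ) b →
    rowRed p j (List.tabulate f) b ≡ Defs.∑ (λ i → at (j ℕ.+ toℕ i) b (f i))
  rowRed-tabulate {zero}  j f b = ≡.refl
  rowRed-tabulate {suc n} j f b = ≡.cong₂ ℤ._+_
    (≡.cong (λ k → at k b (f zero)) (≡.sym (ℕ.+-identityʳ j)))
    (≡.trans (rowRed-tabulate (suc j) (f ∘ suc) b)
      (∑ℤ-cong λ i → ≡.cong (λ k → at k b (f (suc i))) (≡.sym (ℕ.+-suc j (toℕ i)))))

  polyRed-tabulate : ∀ {n} j (f : Fin n → List ℤ) a b →
    polyRed p j (List.tabulate f) a b ≡ Defs.∑ (λ i → at (j ℕ.+ toℕ i) a (rowRed p 0 (f i) b))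
  polyRed-tabulate {zero}  j f a b = ≡.refl
  polyRed-tabulate {suc n} j f a b = ≡.cong₂ ℤ._+_
    (≡.cong (λ k → at k a (rowRed p 0 (f zero) b)) (≡.sym (ℕ.+-identityʳ j)))
    (≡.trans (polyRed-tabulate (suc j) (f ∘ suc) a b)
      (∑ℤ-cong λ i → ≡.cong (λ k → at k a (rowRed p 0 (f (suc i)) b)) (≡.sym (ℕ.+-suc j (toℕ i)))))

  reduce-tabulate : ∀ (A : Fin p → Fin p → ℤ) a b →
    Defs.reduce p (List.tabulate (λ a → List.tabulate (A a))) a b ≡ A a b
  reduce-tabulate A a b = begin
    Defs.reduce p F a b                   ≡⟨ reduce≡polyRed p F a b ⟩
    polyRed p 0 F a b                     ≡⟨ polyRed-tabulate 0 (λ i → List.tabulate (A i)) a b ⟩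
    Defs.∑ (λ i → at (toℕ i) a (rowRed p 0 (List.tabulate (A i)) b))
                                          ≡⟨ ∑ℤ-at (λ i → rowRed p 0 (List.tabulate (A i)) b) a ⟩
    rowRed p 0 (List.tabulate (A a)) b    ≡⟨ rowRed-tabulate 0 (A a) b ⟩
    Defs.∑ (λ i → at (toℕ i) b (A a i))   ≡⟨ ∑ℤ-at (A a) b ⟩
    A a b                                 ∎
    where
    F : Defs.Poly
    F = List.tabulate (λ a → List.tabulate (A a))

  -- Opaque, lest the type checker compute the group determinant of a polynomial.
  opaque
    polynomial : (Fin p → Fin p → ℤ) → Defs.Poly
    polynomial A = List.tabulate (λ a → List.tabulate (A a))

    reduce-polynomial : ∀ A a b → Defs.reduce p (polynomial A) a b ≡ A a b
    reduce-polynomial = reduce-tabulate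

-- Integer sums and linear congruences

module IntegerSums where
  open import Data.Integer using (_+_; _*_; -_; _-_)

  ∑ℤ-linear : ∀ {n} x y (f g : Fin n → ℤ) → Defs.∑ (λ i → x * f i + y * g i) ≡ x * Defs.∑ f + y * Defs.∑ g
  ∑ℤ-linear {zero}  x y f g = ≡.sym (≡.cong₂ _+_ (ℤ.*-zeroʳ x) (ℤ.*-zeroʳ y))
  ∑ℤ-linear {suc n} x y f g = ≡.trans
    (≡.cong (λ z → x * f zero + y * g zero + z) (∑ℤ-linear x y (f ∘ suc) (g ∘ suc)))
    (collect x y (f zero) (g zero) _ _)
    where
    collect : ∀ x y a b s t → x * a + y * b + (x * s + y * t) ≡ x * (a + s) + y * (b + t)
    collect = solve-∀

  ∑∑ : ∀ {m n} → (Fin m → Fin n → ℤ) → ℤ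
  ∑∑ f = Defs.∑ (λ i → Defs.∑ (f i))

  ∑∑-linear : ∀ {m n} x y (f g : Fin m → Fin n → ℤ) →
              ∑∑ (λ i j → x * f i j + y * g i j) ≡ x * ∑∑ f + y * ∑∑ g
  ∑∑-linear x y f g = ≡.trans (∑ℤ-cong λ i → ∑ℤ-linear x y (f i) (g i))
    (∑ℤ-linear x y (λ i → Defs.∑ (f i)) (λ i → Defs.∑ (g i)))

  inverse-mod : ∀ {p} → Prime p → ∀ b → ¬ (+ p ℤ.∣ b) → ∃ λ c → ∃ λ k → b * c ≡ + 1 + k * + p
  inverse-mod {p} pr (+ m) p∤b with modular-inverse pr p∤b
  ... | m′ , x , y , e = + m′ , + y - + x , (begin
    + m * + m′                                  ≡⟨ isolate (+ m * + m′) (+ x * + p) ⟩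
    (+ m * + m′ + + x * + p) - + x * + p        ≡⟨ ≡.cong (_- + x * + p) (cast m m′ x) ⟨
    + (m ℕ.* m′ ℕ.+ x ℕ.* p) - + x * + p        ≡⟨ ≡.cong (λ z → + z - + x * + p) e ⟩
    + (1 ℕ.+ y ℕ.* p) - + x * + p               ≡⟨ ≡.cong (λ z → + 1 + z - + x * + p) (ℤ.pos-* y p) ⟩
    + 1 + + y * + p - + x * + p                 ≡⟨ collect (+ x) (+ y) (+ p) ⟩
    + 1 + (+ y - + x) * + p                     ∎)
    where
    open ≡.≡-Reasoning
    cast : ∀ m m′ x → + (m ℕ.* m′ ℕ.+ x ℕ.* p) ≡ + m * + m′ + + x * + p
    cast m m′ x = ≡.trans (ℤ.pos-+ (m ℕ.* m′) (x ℕ.* p)) (≡.cong₂ _+_ (ℤ.pos-* m m′) (ℤ.pos-* x p))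
    isolate : ∀ a b → a ≡ (a + b) - b
    isolate = solve-∀
    collect : ∀ x y p → + 1 + y * p - x * p ≡ + 1 + (y - x) * p
    collect = solve-∀
  inverse-mod pr -[1+ n ] p∤b with inverse-mod pr (+ suc n) p∤b
  ... | c , k , e = - c , k , ≡.trans (neg-neg (+ suc n) c) e
    where
    neg-neg : ∀ b c → - b * - c ≡ b * c
    neg-neg = solve-∀

  -- Take for j the residue of -a c, where b c ≡ 1 modulo p.
  solve-mod : ∀ {p} .{{_ : NonZero p}} → Prime p → ∀ a b → ¬ (+ p ℤ.∣ b) →
              ∃ λ (j : Fin p) → + p ℤ.∣ a + + toℕ j * b
  solve-mod {p} pr a b p∤b with inverse-mod pr b p∤b
  ... | c , k , e = j , ℤˢ.∣⇒∣ᵤ (ℤˢ.divides (- (a * k) - z ℤ./ℕ p * b) (begin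
    a + + toℕ j * b                               ≡⟨ isolate a (+ toℕ j) b (z ℤ./ℕ p) (+ p) ⟩
    a + (+ toℕ j + z ℤ./ℕ p * + p) * b - z ℤ./ℕ p * + p * b
      ≡⟨ ≡.cong (λ t → a + t * b - z ℤ./ℕ p * + p * b) z≡ ⟨
    a + - (a * c) * b - z ℤ./ℕ p * + p * b        ≡⟨ regroup a b c (z ℤ./ℕ p) (+ p) ⟩
    a - a * (b * c) - z ℤ./ℕ p * + p * b          ≡⟨ ≡.cong (λ t → a - a * t - z ℤ./ℕ p * + p * b) e ⟩
    a - a * (+ 1 + k * + p) - z ℤ./ℕ p * + p * b  ≡⟨ collect a b k (z ℤ./ℕ p) (+ p) ⟩
    (- (a * k) - z ℤ./ℕ p * b) * + p              ∎))
    where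
    open ≡.≡-Reasoning
    z = - (a * c)
    j = Fin.fromℕ< (ℤ.n%ℕd<d z p)
    z≡ : z ≡ + toℕ j + z ℤ./ℕ p * + p
    z≡ = ≡.trans (ℤ.a≡a%ℕn+[a/ℕn]*n z p)
      (≡.cong (λ r → + r + z ℤ./ℕ p * + p) (≡.sym (Fin.toℕ-fromℕ< (ℤ.n%ℕd<d z p))))
    isolate : ∀ a j b q p → a + j * b ≡ a + (j + q * p) * b - q * p * b
    isolate = solve-∀
    regroup : ∀ a b c q p → a + - (a * c) * b - q * p * b ≡ a - a * (b * c) - q * p * b
    regroup = solve-∀
    collect : ∀ a b k q p → a - a * (+ 1 + k * p) - q * p * b ≡ (- (a * k) - q * b) * p
    collect = solve-∀

open IntegerSums

-- Orders of the eigenvalues and the lower bound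

module Valuations {m : ℕ} (pr : Prime (3 ℕ.+ m)) (K : CyclotomicIntegers (3 ℕ.+ m)) where
  open CyclotomicPrime pr (s<s z<s) K
  open GroupDeterminant pr K
  open import Relation.Binary.Reasoning.Setoid setoid

  unit-∏ : ∀ {n} {f : Fin n → Carrier} → (∀ i → Unit (f i)) → Unit (∏ f)
  unit-∏ {zero}  h = unit-≈ (sym (∏-zero _)) unit-1
  unit-∏ {suc n} h = unit-≈ (sym (∏-suc _)) (unit-* (h zero) (unit-∏ (h ∘ suc)))

  p∤toℕ-suc : ∀ (i : Fin (2 ℕ.+ m)) → ¬ (p ℕ.∣ toℕ (Fin.suc i))
  p∤toℕ-suc i d = ℕ.<⇒≱ (Fin.toℕ<n (Fin.suc i)) (ℕ.∣⇒≤ d)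

  private
    -- This is p + 2, in the form 3 + q in which `∥-∏∏` supplies it.
    ℓ : ℕ
    ℓ = 3 ℕ.+ (2 ℕ.+ m)

  module _ (a : Fin p → Fin p → ℤ) where
    private
      -- Value and partial derivatives at (1 , 1) of the reduced polynomial with coefficients a.
      N α β : ℤ
      N = ∑∑ a
      α = ∑∑ (λ h₁ h₂ → a h₁ h₂ ℤ.* + toℕ h₁)
      β = ∑∑ (λ h₁ h₂ → a h₁ h₂ ℤ.* + toℕ h₂)

      slope : Fin p → Fin p → ℤ
      slope i j = + toℕ i ℤ.* α ℤ.+ + toℕ j ℤ.* β

      exponent : (i j h₁ h₂ : Fin p) → ℕ
      exponent i j h₁ h₂ = toℕ h₁ ℕ.* toℕ i ℕ.+ toℕ h₂ ℕ.* toℕ j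

      slope≡ : ∀ i j → ∑∑ (λ h₁ h₂ → a h₁ h₂ ℤ.* + exponent i j h₁ h₂) ≡ slope i j
      slope≡ i j = ≡.trans (∑ℤ-cong λ h₁ → ∑ℤ-cong λ h₂ → ≡.trans
          (≡.cong (a h₁ h₂ ℤ.*_) (≡.trans (ℤ.pos-+ (toℕ h₁ ℕ.* toℕ i) (toℕ h₂ ℕ.* toℕ j))
            (≡.cong₂ ℤ._+_ (ℤ.pos-* (toℕ h₁) (toℕ i)) (ℤ.pos-* (toℕ h₂) (toℕ j)))))
          (collect (a h₁ h₂) (+ toℕ h₁) (+ toℕ h₂) (+ toℕ i) (+ toℕ j)))
        (∑∑-linear (+ toℕ i) (+ toℕ j) (λ h₁ h₂ → a h₁ h₂ ℤ.* + toℕ h₁) (λ h₁ h₂ → a h₁ h₂ ℤ.* + toℕ h₂))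
        where
        collect : ∀ a h k i j → a ℤ.* (h ℤ.* i ℤ.+ k ℤ.* j) ≡ i ℤ.* (a ℤ.* h) ℤ.+ j ℤ.* (a ℤ.* k)
        collect = solve-∀

      ∑-ι : ∀ {n} (f g : Fin n → ℤ) y → ∑ (λ i → ι (f i) + ι (g i) * y) ≈ ι (Defs.∑ f) + ι (Defs.∑ g) * y
      ∑-ι f g y = trans (∑-+ _ _) (+-cong (sym (ι-∑ f)) (trans (sym (∑-* y _)) (*-congʳ (sym (ι-∑ g)))))

    opaque
      eigenvalue-jet : ∀ i j → eigenvalue a i j ≈ ι N + ι (slope i j) * - π mod (π * π)
      eigenvalue-jet i j = mod-trans (mod-∑ λ h₁ → mod-∑ λ h₂ → term h₁ h₂) (≈⇒mod (begin
        ∑ (λ h₁ → ∑ (λ h₂ → ι (a h₁ h₂) + ι (a h₁ h₂ ℤ.* + exponent i j h₁ h₂) * - π))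
          ≈⟨ ∑-cong (λ h₁ → ∑-ι (a h₁) _ (- π)) ⟩
        ∑ (λ h₁ → ι (Defs.∑ (a h₁)) + ι (Defs.∑ (λ h₂ → a h₁ h₂ ℤ.* + exponent i j h₁ h₂)) * - π)
          ≈⟨ ∑-ι _ _ (- π) ⟩
        ι N + ι (∑∑ (λ h₁ h₂ → a h₁ h₂ ℤ.* + exponent i j h₁ h₂)) * - π
          ≡⟨ ≡.cong (λ s → ι N + ι s * - π) (slope≡ i j) ⟩
        ι N + ι (slope i j) * - π ∎))
        where
        term : ∀ h₁ h₂ → ι (a h₁ h₂) * (χ h₁ i * χ h₂ j) ≈
               ι (a h₁ h₂) + ι (a h₁ h₂ ℤ.* + exponent i j h₁ h₂) * - π mod (π * π)
        term h₁ h₂ = mod-trans (mod-* (≈⇒mod {ι (a h₁ h₂)} refl)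
          (mod-trans (≈⇒mod (sym (^-homo-* w (toℕ h₁ ℕ.* toℕ i) (toℕ h₂ ℕ.* toℕ j)))) (w^≈1-mπ (exponent i j h₁ h₂))))
          (≈⇒mod (trans (solve 3 (λ a e x → a :* (con (+ 1) :- e :* x) := a :+ (a :* e) :* (:- x)) refl _ _ π)
            (+-congˡ (*-congʳ (sym (ι-* _ _))))))

    eigenvalue-00 : eigenvalue a zero zero ≈ ι N
    eigenvalue-00 = trans (∑-cong λ h₁ → trans (∑-cong λ h₂ → trans
        (*-congˡ (trans (*-cong (χ-0 h₁) (χ-0 h₂)) (*-identityˡ 1#))) (*-identityʳ _)) (sym (ι-∑ _)))
      (sym (ι-∑ _))
      where
      χ-0 : ∀ h → χ h zero ≈ 1#
      χ-0 h = reflexive (≡.cong (w ^_) (ℕ.*-zeroʳ (toℕ h)))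

    -- Every eigenvalue is N modulo π, so their product is a power of N modulo π.
    p∤N⇒unit : ¬ (+ p ℤ.∣ N) → Unit (ι (Defs.groupDet p a))
    p∤N⇒unit p∤N = unit-≈ (sym (groupDet≈∏eigenvalue a)) (unit-∏ λ i → unit-∏ λ j → unit N
      (mod-trans (mod-π² (eigenvalue-jet i j)) (- ι (slope i j) ,
        solve 3 (λ n s x → n :+ s :* (:- x) := n :+ x :* (:- s)) refl _ _ π)) p∤N)

    open Valuation (λ _ → ⊤) _ _

    module _ (p∣N : + p ℤ.∣ N) where

      π∥eigenvalue : ∀ i j → π ∥ eigenvalue a i j
      π∥eigenvalue i j = let t , e = eigenvalue-jet i j ; y , e′ = ι-p∣ {N} p∣N in
        π * y - ι (slope i j) + π * t , trans e (trans (+-congʳ (+-congʳ e′))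
        (solve 4 (λ x y s t → (x :* x) :* y :+ s :* (:- x) :+ (x :* x) :* t := x :* (x :* y :- s :+ x :* t))
          refl π y _ t)) , _

      π²∥eigenvalue : ∀ i j → + p ℤ.∣ slope i j → (π * π) ∥ eigenvalue a i j
      π²∥eigenvalue i j d = let t , e = eigenvalue-jet i j ; y , e′ = ι-p∣ {N} p∣N ; z , e″ = ι-p∣ {slope i j} d in
        y + z * - π + t , trans e (trans (+-congʳ (+-cong e′ (*-congʳ e″)))
        (solve 4 (λ x y z t → (x :* x) :* y :+ ((x :* x) :* z) :* (:- x) :+ (x :* x) :* t
          := (x :* x) :* (y :+ z :* (:- x) :+ t)) refl π y z t)) , _

      p∥eigenvalue-00 : ι (+ p) ∥ eigenvalue a zero zero
      p∥eigenvalue-00 = let ℤˢ.divides k e = ℤˢ.∣ᵤ⇒∣ {+ p} {N} p∣N in ι k ,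
        trans eigenvalue-00 (trans (reflexive (≡.cong ι e)) (trans (ι-* _ _) (*-comm _ _))) , _

      -- If p ∣ β, the second-order zeros are the (0 , j); otherwise there is one in every row.
      ∥groupDet : Dec (+ p ℤ.∣ β) → (ι (+ p) * (ι (+ (p ℕ.^ ℓ)) * u ^ ℓ)) ∥ ι (Defs.groupDet p a)
      ∥groupDet (yes p∣β) = ∥-≈ refl (sym (trans (groupDet≈∏eigenvalue a) (∏-comm (eigenvalue a))))
        (∥-∏∏ (λ j i → eigenvalue a i j) p∥eigenvalue-00 (λ i → π∥eigenvalue (suc i) zero)
          λ j → zero , π²∥eigenvalue zero (suc j) (ℤˢ.∣⇒∣ᵤ {+ p} (≡.subst (ℤˢ._∣_ (+ p)) (≡.sym (ℤ.+-identityˡ _))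
              (ℤˢ.∣n⇒∣m*n (+ toℕ (suc j)) (ℤˢ.∣ᵤ⇒∣ {+ p} {β} p∣β))))
            , λ i _ → π∥eigenvalue i (suc j))
      ∥groupDet (no p∤β) = ∥-≈ refl (sym (groupDet≈∏eigenvalue a))
        (∥-∏∏ (eigenvalue a) p∥eigenvalue-00 (λ j → π∥eigenvalue zero (suc j))
          λ i → let j , d = solve-mod pr (+ toℕ (suc i) ℤ.* α) β p∤β in
            j , π²∥eigenvalue (suc i) j d , λ j′ _ → π∥eigenvalue (suc i) j′)

    p∣groupDet⇒p^∣groupDet : + p ℤ.∣ Defs.groupDet p a → + (p ℕ.^ (p ℕ.+ 3)) ℤ.∣ Defs.groupDet p a
    p∣groupDet⇒p^∣groupDet d = split (p ℕ.∣? ℤ.∣ N ∣)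
      where
      split : Dec (+ p ℤ.∣ N) → + (p ℕ.^ (p ℕ.+ 3)) ℤ.∣ Defs.groupDet p a
      split (no p∤N) = let y , e = ι-p∣ {Defs.groupDet p a} d in
        contradiction (unit-≈ (trans e (*-assoc π π y)) (p∤N⇒unit p∤N)) ¬unit-multiple
      split (yes p∣N) = let v , e , _ = ∥groupDet p∣N (p ℕ.∣? ℤ.∣ β ∣) in ι-∣ {x = u ^ ℓ * v} (begin
        ι (Defs.groupDet p a)                              ≈⟨ e ⟩
        (ι (+ p) * (ι (+ (p ℕ.^ ℓ)) * u ^ ℓ)) * v
          ≈⟨ solve 4 (λ a b c d → (a :* (b :* c)) :* d := (a :* b) :* (c :* d)) refl _ _ _ v ⟩
        (ι (+ p) * ι (+ (p ℕ.^ ℓ))) * (u ^ ℓ * v)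
          ≈⟨ *-congʳ (trans (sym (ι-* _ _)) (reflexive (≡.cong ι (≡.trans (≡.sym (ℤ.pos-* p (p ℕ.^ ℓ)))
               (≡.cong (λ e → + (p ℕ.^ e)) (ℕ.+-comm 3 p)))))) ⟩
        ι (+ (p ℕ.^ (p ℕ.+ 3))) * (u ^ ℓ * v)              ∎)

  -- Polynomials attaining each exponent

  module Witness (k : ℕ) where
    private
      δ : Fin p → Fin p → ℤ
      δ x h = if does (h Fin.≟ x) then + 1 else + 0

      1F 2F : Fin p
      1F = suc zero
      2F = suc (suc zero)

      c : ℤ
      c = + (p ℕ.^ k)

    -- Coefficients of (y - 1) + (x - 1)² + p^k (1 + x + ⋯ + x^(p-1)).
    coefficients : Fin p → Fin p → ℤ
    coefficients h₁ h₂ = δ zero h₂ ℤ.* (c ℤ.+ (-[1+ 1 ] ℤ.* δ 1F h₁ ℤ.+ δ 2F h₁)) ℤ.+ δ 1F h₂ ℤ.* δ zero h₁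

    private
      ∑-δ : ∀ x (f : Fin p → Carrier) → ∑ (λ h → ι (δ x h) * f h) ≈ f x
      ∑-δ x f = trans (∑-single x λ h h≢x → trans (*-congʳ (δ-≢ h≢x)) (zeroˡ _))
                      (trans (*-congʳ δ-≡) (*-identityˡ _))
        where
        δ-≢ : ∀ {h} → h ≢ x → ι (δ x h) ≈ 0#
        δ-≢ {h} h≢x rewrite dec-false (h Fin.≟ x) h≢x = ι-0
        δ-≡ : ι (δ x x) ≈ 1#
        δ-≡ rewrite dec-true (x Fin.≟ x) ≡.refl = ι-1

      G : Fin p → Carrier
      G i = ∑ (λ h → χ h i)

      row : ∀ i j h₁ → ∑ (λ h₂ → ι (coefficients h₁ h₂) * (χ h₁ i * χ h₂ j)) ≈
            (ι c * χ h₁ i + (ι (δ 1F h₁) * (ι -[1+ 1 ] * χ h₁ i) + ι (δ 2F h₁) * χ h₁ i))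
            + ι (δ zero h₁) * (χ h₁ i * χ 1F j)
      row i j h₁ = begin
        ∑ (λ h₂ → ι (coefficients h₁ h₂) * (χ h₁ i * χ h₂ j))
          ≈⟨ ∑-cong (λ h₂ → trans (*-congʳ (trans (ι-+ _ _) (+-cong (ι-* _ _) (ι-* _ _))))
               (solve 6 (λ d g e f x y → (d :* g :+ e :* f) :* (x :* y) := d :* (g :* (x :* y)) :+ e :* (f :* (x :* y)))
                 refl _ _ _ _ _ _)) ⟩
        ∑ (λ h₂ → ι (δ zero h₂) * (g * (χ h₁ i * χ h₂ j)) + ι (δ 1F h₂) * (ι (δ zero h₁) * (χ h₁ i * χ h₂ j)))
          ≈⟨ trans (∑-+ _ _) (+-cong (∑-δ zero λ h₂ → g * (χ h₁ i * χ h₂ j))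
                                     (∑-δ 1F λ h₂ → ι (δ zero h₁) * (χ h₁ i * χ h₂ j))) ⟩
        g * (χ h₁ i * 1#) + ι (δ zero h₁) * (χ h₁ i * χ 1F j)
          ≈⟨ +-congʳ (*-cong (trans (ι-+ _ _) (+-congˡ (trans (ι-+ _ _) (+-congʳ (ι-* _ _))))) (*-identityʳ _)) ⟩
        (ι c + (ι -[1+ 1 ] * ι (δ 1F h₁) + ι (δ 2F h₁))) * χ h₁ i + ι (δ zero h₁) * (χ h₁ i * χ 1F j)
          ≈⟨ +-congʳ (solve 5 (λ c n d e x → (c :+ (n :* d :+ e)) :* x := c :* x :+ (d :* (n :* x) :+ e :* x))
               refl _ _ _ _ _) ⟩
        _ ∎
        where
        g : Carrier
        g = ι (c ℤ.+ (-[1+ 1 ] ℤ.* δ 1F h₁ ℤ.+ δ 2F h₁))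

    eigenvalue≈ : ∀ i j → eigenvalue coefficients i j ≈
      ι c * G i + ((w ^ toℕ j - 1#) + (w ^ toℕ i - 1#) * (w ^ toℕ i - 1#))
    eigenvalue≈ i j = begin
      eigenvalue coefficients i j   ≈⟨ ∑-cong (row i j) ⟩
      _   ≈⟨ trans (∑-+ _ _) (+-cong (trans (∑-+ _ _) (+-cong (sym (*-∑ _ _))
               (trans (∑-+ _ _) (+-cong (∑-δ 1F λ h → ι -[1+ 1 ] * χ h i) (∑-δ 2F λ h → χ h i)))))
               (∑-δ zero λ h → χ h i * χ 1F j)) ⟩
      (ι c * G i + (ι -[1+ 1 ] * χ 1F i + χ 2F i)) + 1# * χ 1F j
          ≈⟨ +-cong (+-congˡ (+-cong (*-congˡ χ₁) χ₂)) (*-congˡ (reflexive (≡.cong (w ^_) (ℕ.*-identityˡ (toℕ j))))) ⟩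
      (ι c * G i + (ι -[1+ 1 ] * x + x * x)) + 1# * y
          -- The constant terms of y - 1 and (x - 1)² cancel; besides the multiple of 1 + x + ⋯ +
          -- x^(p-1) the coefficients encode only y, x² and -2 x.
          ≈⟨ solve 3 (λ g x y → (g :+ (con -[1+ 1 ] :* x :+ x :* x)) :+ con (+ 1) :* y
               := g :+ ((y :- con (+ 1)) :+ (x :- con (+ 1)) :* (x :- con (+ 1)))) refl _ x y ⟩
      ι c * G i + ((y - 1#) + (x - 1#) * (x - 1#)) ∎
      where
      x = w ^ toℕ i
      y = w ^ toℕ j
      χ₁ : χ 1F i ≈ x
      χ₁ = reflexive (≡.cong (w ^_) (ℕ.*-identityˡ (toℕ i)))
      χ₂ : χ 2F i ≈ x * x
      χ₂ = trans (reflexive (≡.cong (λ e → w ^ (toℕ i ℕ.+ e)) (ℕ.+-identityʳ (toℕ i)))) (^-homo-* w (toℕ i) (toℕ i))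

    G-zero : G zero ≈ ι (+ p)
    G-zero = trans (∑-cong λ h → reflexive (≡.cong (w ^_) (ℕ.*-zeroʳ (toℕ h)))) (∑-1 p)

    G-suc : ∀ i → G (suc i) ≈ 0#
    G-suc i = trans (∑-cong λ h → trans (reflexive (≡.cong (w ^_) (ℕ.*-comm (toℕ h) (toℕ (suc i)))))
      (sym (^-assocʳ w (toℕ (suc i)) (toℕ h)))) (∑-w^m-∤ pr (p∤toℕ-suc i))

    private
      module _ (i : Fin (2 ℕ.+ m)) where
        n : ℕ
        n = toℕ (Fin.suc i)

        -- The cofactor is -n modulo π, hence prime to π for 0 < n < p; the exact orders of the
        -- witness all come from it.
        root : ∃ λ t → w ^ n - 1# ≈ π * (ι (ℤ.- + n) + π * t)
        root = let t , e = w^≈1-mπ n in t , trans (+-congʳ e) (trans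
          (solve 3 (λ n x t → (con (+ 1) :- n :* x) :+ x :* x :* t :- con (+ 1) := x :* (:- n :+ x :* t)) refl _ π t)
          (*-congˡ (+-congʳ (sym (ι-neg (+ n))))))

        unit-root : ∀ s → Unit (ι (ℤ.- + n) + π * s)
        unit-root s = unit (ℤ.- + n) (s , refl) λ d → p∤toℕ-suc i (≡.subst (p ℕ.∣_) (ℤ.∣-i∣≡∣i∣ (+ n)) d)

    open Valuation Unit unit-1 unit-*

    ∥eigenvalue-00 : ι (+ (p ℕ.^ suc k)) ∥ eigenvalue coefficients zero zero
    ∥eigenvalue-00 = 1# , (begin
      eigenvalue coefficients zero zero   ≈⟨ eigenvalue≈ zero zero ⟩
      ι c * G zero + ((1# - 1#) + (1# - 1#) * (1# - 1#))
        ≈⟨ +-congʳ (*-congˡ G-zero) ⟩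
      ι c * ι (+ p) + ((1# - 1#) + (1# - 1#) * (1# - 1#))
        ≈⟨ solve 2 (λ c p → c :* p :+ ((con (+ 1) :- con (+ 1)) :+ (con (+ 1) :- con (+ 1)) :* (con (+ 1) :- con (+ 1)))
             := (p :* c) :* con (+ 1)) refl (ι c) (ι (+ p)) ⟩
      (ι (+ p) * ι c) * 1#
        ≈⟨ *-congʳ (trans (reflexive (≡.cong ι (ℤ.pos-* p (p ℕ.^ k)))) (ι-* _ _)) ⟨
      ι (+ (p ℕ.^ suc k)) * 1# ∎) , unit-1

    -- The term y - 1 has order exactly 1, and what is added to it has order at least 2: for i = 0
    -- it is p^(k+1), where π² ∣ p, and for i ≠ 0 it is (w^i - 1)².
    π∥eigenvalue-suc : ∀ i j → π ∥ eigenvalue coefficients i (suc j)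
    π∥eigenvalue-suc zero j = let t , e = root j ; y , e′ = π²∣p in ι (ℤ.- + n j) + π * (t + ι c * y) , (begin
      eigenvalue coefficients zero (suc j)    ≈⟨ eigenvalue≈ zero (suc j) ⟩
      ι c * G zero + ((w ^ n j - 1#) + (1# - 1#) * (1# - 1#))
        ≈⟨ +-cong (*-congˡ (trans G-zero e′)) (+-congʳ e) ⟩
      ι c * ((π * π) * y) + (π * (ι (ℤ.- + n j) + π * t) + (1# - 1#) * (1# - 1#))
        ≈⟨ solve 5 (λ c x y n t → c :* ((x :* x) :* y) :+ (x :* (n :+ x :* t) :+ (con (+ 1) :- con (+ 1)) :* (con (+ 1) :- con (+ 1)))
             := x :* (n :+ x :* (t :+ c :* y))) refl (ι c) π y _ t ⟩
      π * (ι (ℤ.- + n j) + π * (t + ι c * y)) ∎) , unit-root j _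
    π∥eigenvalue-suc (suc i) j = let t , e = root j ; s , e′ = root i ; r = ι (ℤ.- + n i) + π * s in
      ι (ℤ.- + n j) + π * (t + r * r) , (begin
      eigenvalue coefficients (suc i) (suc j)    ≈⟨ eigenvalue≈ (suc i) (suc j) ⟩
      ι c * G (suc i) + ((w ^ n j - 1#) + (w ^ n i - 1#) * (w ^ n i - 1#))
        ≈⟨ +-cong (trans (*-congˡ (G-suc i)) (zeroʳ _)) (+-cong e (*-cong e′ e′)) ⟩
      0# + (π * (ι (ℤ.- + n j) + π * t) + (π * r) * (π * r))
        ≈⟨ solve 4 (λ x n t r → con (+ 0) :+ (x :* (n :+ x :* t) :+ (x :* r) :* (x :* r))
             := x :* (n :+ x :* (t :+ r :* r))) refl π _ t r ⟩
      π * (ι (ℤ.- + n j) + π * (t + r * r)) ∎) , unit-root j _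

    -- At j = 0 the term y - 1 vanishes, and 1 + x + ⋯ + x^(p-1) vanishes at w^i for i ≠ 0; the
    -- square of w^i - 1 is left.
    π²∥eigenvalue-zero : ∀ i → (π * π) ∥ eigenvalue coefficients (suc i) zero
    π²∥eigenvalue-zero i = let s , e = root i ; r = ι (ℤ.- + n i) + π * s in r * r , (begin
      eigenvalue coefficients (suc i) zero    ≈⟨ eigenvalue≈ (suc i) zero ⟩
      ι c * G (suc i) + ((1# - 1#) + (w ^ n i - 1#) * (w ^ n i - 1#))
        ≈⟨ +-cong (trans (*-congˡ (G-suc i)) (zeroʳ _)) (+-congˡ (*-cong e e)) ⟩
      0# + ((1# - 1#) + (π * r) * (π * r))
        ≈⟨ solve 2 (λ x r → con (+ 0) :+ ((con (+ 1) :- con (+ 1)) :+ (x :* r) :* (x :* r)) := (x :* x) :* (r :* r)) refl π r ⟩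
      (π * π) * (r * r) ∎) , unit-* (unit-root i s) (unit-root i s)

    ∥∏∏eigenvalue : (ι (+ (p ℕ.^ suc k)) * (ι (+ (p ℕ.^ ℓ)) * u ^ ℓ)) ∥ ∏ (λ i → ∏ (eigenvalue coefficients i))
    ∥∏∏eigenvalue = ∥-∏∏ (eigenvalue coefficients) ∥eigenvalue-00 (π∥eigenvalue-suc zero)
      λ i → zero , π²∥eigenvalue-zero i ,
        λ { zero 0≢0 → contradiction ≡.refl 0≢0 ; (suc j) _ → π∥eigenvalue-suc (suc i) j }

    -- Reducing the witness polynomial returns its coefficients only pointwise, so the conclusions
    -- are drawn for any a that agrees with them.
    module _ (a : Fin p → Fin p → ℤ) (a≡ : ∀ h₁ h₂ → a h₁ h₂ ≡ coefficients h₁ h₂) where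
      private
        e : ℕ
        e = p ℕ.+ 3 ℕ.+ k

        D : ℤ
        D = Defs.groupDet p a

      groupDet≈ : ∃ λ v → ι D ≈ ι (+ (p ℕ.^ e)) * v × Unit v
      groupDet≈ = let v , h , unit-v = ∥∏∏eigenvalue in
        u ^ ℓ * v , (begin
        ι D                                    ≈⟨ groupDet≈∏eigenvalue a ⟩
        ∏ (λ i → ∏ (eigenvalue a i))
          ≈⟨ ∏-cong (λ i → ∏-cong λ j → ∑-cong λ h₁ → ∑-cong λ h₂ → *-congʳ (reflexive (≡.cong ι (a≡ h₁ h₂)))) ⟩
        ∏ (λ i → ∏ (eigenvalue coefficients i))  ≈⟨ h ⟩
        (ι (+ (p ℕ.^ suc k)) * (ι (+ (p ℕ.^ ℓ)) * u ^ ℓ)) * v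
          ≈⟨ solve 4 (λ a b c d → (a :* (b :* c)) :* d := (a :* b) :* (c :* d)) refl _ _ _ v ⟩
        (ι (+ (p ℕ.^ suc k)) * ι (+ (p ℕ.^ ℓ))) * (u ^ ℓ * v)
          ≈⟨ *-congʳ (trans (*-cong (ι-ℕ^ p (suc k)) (ι-ℕ^ p ℓ))
               (trans (sym (^-homo-* (ι (+ p)) (suc k) ℓ)) (trans (reflexive (≡.cong (ι (+ p) ^_) exponents)) (sym (ι-ℕ^ p e))))) ⟩
        ι (+ (p ℕ.^ e)) * (u ^ ℓ * v) ∎) , unit-* (unit-^ ℓ unit-u) unit-v
        where
        exponents : suc k ℕ.+ ℓ ≡ e
        exponents = arithmetic k m
          where
          arithmetic : ∀ k m → suc k ℕ.+ (3 ℕ.+ (2 ℕ.+ m)) ≡ 3 ℕ.+ m ℕ.+ 3 ℕ.+ k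
          arithmetic = ℕSolver.solve-∀

      p^∣groupDet : + (p ℕ.^ e) ℤ.∣ D
      p^∣groupDet = let v , h , _ = groupDet≈ in ι-∣ {x = v} h

      -- After cancelling p^e, a further factor p would make the cofactor v a multiple of π,
      -- although it is a unit modulo π.
      p^∤groupDet : ¬ (+ (p ℕ.^ (p ℕ.+ 4 ℕ.+ k)) ℤ.∣ D)
      p^∤groupDet d = let v , h , unit-v = groupDet≈
                          ℤˢ.divides z D≡ = ℤˢ.∣ᵤ⇒∣ {+ (p ℕ.^ (p ℕ.+ 4 ℕ.+ k))} {D} d
                          s , p≈ = π∣p in
        ¬unit-multiple (unit-≈ (regular-cancel regular (begin
        ι (+ (p ℕ.^ e)) * v                       ≈⟨ h ⟨
        ι D                                       ≡⟨ ≡.cong ι D≡ ⟩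
        ι (z ℤ.* + (p ℕ.^ (p ℕ.+ 4 ℕ.+ k)))       ≈⟨ ι-* _ _ ⟩
        ι z * ι (+ (p ℕ.^ (p ℕ.+ 4 ℕ.+ k)))
          ≈⟨ *-congˡ (trans (reflexive (≡.cong (λ e → ι (+ (p ℕ.^ e))) exponents)) (trans (ι-ℕ^ p (suc e))
               (*-cong p≈ (sym (ι-ℕ^ p e))))) ⟩
        ι z * ((π * s) * ι (+ (p ℕ.^ e)))
          ≈⟨ solve 4 (λ z x s p → z :* ((x :* s) :* p) := p :* (x :* (s :* z))) refl _ π s _ ⟩
        ι (+ (p ℕ.^ e)) * (π * (s * ι z))         ∎)) unit-v)
        where
        regular : Regular (ι (+ (p ℕ.^ e)))
        regular = regular-≈ (sym (ι-ℕ^ p e)) (regular-^ e torsion-free)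
        exponents : p ℕ.+ 4 ℕ.+ k ≡ suc e
        exponents = ≡.cong (ℕ._+ k) (ℕ.+-suc p 3)

open import Defs
open import Data.Nat using (ℕ; NonZero; _≤_; _^_; _+_)
open import Data.Nat.Primality using (Prime)
open import Data.Integer using (+_)
open import Data.Integer.Divisibility using (_∣_)
open import Data.Product using (_×_; Σ)
open import Relation.Nullary using (¬_)

theorem1 : (p : ℕ) → .{{_ : NonZero p}} → Prime p → 3 ≤ p →
           (((F : Poly) → + p ∣ M p F → + (p ^ (p + 3)) ∣ M p F)
           × ((k : ℕ) → Σ Poly (λ F → (+ (p ^ (p + 3 + k)) ∣ M p F)
                                        × ¬ (+ (p ^ (p + 4 + k)) ∣ M p F))))
theorem1 (suc (suc (suc m))) pr (s≤s (s≤s (s≤s _))) =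
  (λ F → V.p∣groupDet⇒p^∣groupDet (reduce (3 + m) F)) ,
  (λ k → let A = V.Witness.coefficients k in polynomial A ,
    V.Witness.p^∣groupDet k (reduce (3 + m) (polynomial A)) (reduce-polynomial A) ,
    V.Witness.p^∤groupDet k (reduce (3 + m) (polynomial A)) (reduce-polynomial A))
  where
  -- `ShiftOperators` counts its prime as 2 plus the parameter and `Valuations` as 3 plus it; hence
  -- `suc m`.
  module V = Valuations {m} pr (ShiftOperators.cyclotomicIntegers (suc m))
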